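{- Let $n\ge2$ with $n\equiv 2$ or $3\pmod 4$. Any $\mathrm{OA}(n+1,n)$ has at least $\lceil n/4\rceil$ equiparity Latin squares in its ensemble.
   Context: An orthogonal array $\mathrm{OA}(k,n)$ on an alphabet $\Lambda$ with $|\Lambda|=n$ is an $n^2\times k$ matrix $A=(a_{r\ell})$ with entries in $\Lambda$ such that in every pair of distinct columns each ordered pair in $\Lambda^2$ occurs in exactly one row. The ensemble of $A$ is the family of Latin squares indexed by the $\binom{k}{3}$ choices of columns $i<j<\ell$ of $A$ (Latin squares are counted once for each choice of three columns): the Latin square for $i<j<\ell$ has rows and columns indexed by $\Lambda$, and for each row $r$ of $A$ its entry in row $a_{ri}$, column $a_{rj}$ is $a_{r\ell}$. For a Latin square $L=(l_{xy})$ with rows, columns and symbols indexed by $\Lambda$, the row-parity $\pi_r\in\mathbb{Z}_2$ is the sum of the parities ($0$ even, $1$ odd) of the $n$ permutations $y\mapsto l_{xy}$ ($x\in\Lambda$ fixed); the column-parity $\pi_c$ is the sum of the parities of the $n$ permutations $x\mapsto l_{xy}$ ($y$ fixed); the symbol-parity $\pi_s$ is the sum of the parities of the $n$ permutations mapping $x\mapsto y$ whenever $l_{xy}=s$ ($s$ fixed). $L$ is equiparity if $\pi_r=\pi_c=\pi_s$. -}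

module Defs where

open import Data.Fin using (Fin; _<_; _<?_)
open import Data.Fin.Permutation using (Permutation′; _⟨$⟩ʳ_)
open import Data.Fin.Properties using (<⇒≢; <-trans)
open import Data.Bool using (if_then_else_)
open import Data.List using (List; length; filter; map; mapMaybe; allFin; cartesianProduct)
import Data.Maybe as Maybe
open Maybe using (Maybe)
open import Data.Nat using (ℕ; _+_; _^_; pred; NonZero)
open import Data.Nat.DivMod using (_/_)
open import Data.Parity using (Parity; 0ℙ; 1ℙ)
import Data.Parity.Properties as ℙ
open import Data.Product using (_×_; _,_; proj₁; proj₂; ∃!)
open import Function using (_↔_; Inverse; mk↔ₛ′; id; case_of_)
open import Function.Construct.Composition using (_↔-∘_)
open import Function.Construct.Symmetry using (↔-sym)
open import Relation.Binary.PropositionalEquality using (_≡_; _≢_; refl; trans; cong)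
open import Relation.Nullary using (Dec; does)
open import Relation.Nullary.Decidable using (_×-dec_; dec⇒maybe)

import Algebra.Properties.CommutativeMonoid.Sum ℙ.+-0-commutativeMonoid as ℙSum

⌈_/_⌉ : (m d : ℕ) .{{_ : NonZero d}} → ℕ
⌈ m / d ⌉ = (m + pred d) / d

bijection : {A : Set} (R : A → A → Set) →
            (∀ x → ∃! _≡_ λ y → R x y) →
            (∀ y → ∃! _≡_ λ x → R x y) →
            A ↔ A
bijection R f g = mk↔ₛ′
  (λ x → proj₁ (f x))
  (λ y → proj₁ (g y))
  (λ y → proj₂ (proj₂ (f (proj₁ (g y)))) (proj₁ (proj₂ (g y))))
  (λ x → proj₂ (proj₂ (g (proj₁ (f x)))) (proj₁ (proj₂ (f x))))

record LatinSquare (Λ : Set) : Set where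
  field
    entry    : Λ → Λ → Λ
    row∃!    : ∀ x s → ∃! _≡_ λ y → entry x y ≡ s
    column∃! : ∀ y s → ∃! _≡_ λ x → entry x y ≡ s

  rowPerm : Λ → Λ ↔ Λ
  rowPerm x = bijection (λ y s → entry x y ≡ s)
    (λ y → entry x y , refl , id) (row∃! x)

  columnPerm : Λ → Λ ↔ Λ
  columnPerm y = bijection (λ x s → entry x y ≡ s)
    (λ x → entry x y , refl , id) (column∃! y)

  symbolPerm : Λ → Λ ↔ Λ
  symbolPerm s = bijection (λ x y → entry x y ≡ s)
    (λ x → row∃! x s) (λ y → column∃! y s)

-- The number of inversions modulo 2.
inversionParity : ∀ {n} → Permutation′ n → Parity
inversionParity π = ℙSum.sum λ i → ℙSum.sum λ j →
  if does ((i <? j) ×-dec ((π ⟨$⟩ʳ j) <? (π ⟨$⟩ʳ i))) then 1ℙ else 0ℙ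

-- The parity of a permutation of a finite set is read off after conjugating by
-- an enumeration; its value does not depend on which enumeration is used.
module _ {Λ : Set} {n : ℕ} (enum : Λ ↔ Fin n) where

  parity : Λ ↔ Λ → Parity
  parity p = inversionParity (enum ↔-∘ (p ↔-∘ ↔-sym enum))

  sumOver : (Λ → Parity) → Parity
  sumOver f = ℙSum.sum λ i → f (Inverse.from enum i)

  module _ (L : LatinSquare Λ) where
    open LatinSquare L

    πr πc πs : Parity
    πr = sumOver λ x → parity (rowPerm x)
    πc = sumOver λ y → parity (columnPerm y)
    πs = sumOver λ s → parity (symbolPerm s)

    Equiparity : Set
    Equiparity = πr ≡ πc × πc ≡ πs

    equiparity? : Dec Equiparity
    equiparity? = (πr ℙ.≟ πc) ×-dec (πc ℙ.≟ πs)

record ColumnTriple (k : ℕ) : Set where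
  constructor triple
  field
    i j ℓ : Fin k
    i<j   : i < j
    j<ℓ   : j < ℓ

-- Every triple i < j < ℓ, each exactly once.
columnTriples : ∀ k → List (ColumnTriple k)
columnTriples k =
  mapMaybe increasing (cartesianProduct (allFin k) (cartesianProduct (allFin k) (allFin k)))
  where
  increasing : Fin k × Fin k × Fin k → Maybe (ColumnTriple k)
  increasing (i , j , ℓ) =
    Maybe.map (λ (p , q) → triple i j ℓ p q) (dec⇒maybe ((i <? j) ×-dec (j <? ℓ)))

record OA (k n : ℕ) (Λ : Set) : Set where
  field
    enum       : Λ ↔ Fin n
    array      : Fin (n ^ 2) → Fin k → Λ
    orthogonal : ∀ {i j} → i ≢ j → ∀ x y →
                 ∃! _≡_ λ r → array r i ≡ x × array r j ≡ y

  latinSquare : ColumnTriple k → LatinSquare Λ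
  latinSquare (triple i j ℓ i<j j<ℓ) = record
    { entry    = entry
    ; row∃!    = λ x s → case orthogonal i≢ℓ x s of λ where
        (r , (ri≡x , rℓ≡s) , unique) →
            array r j
          , trans (entry-row r ri≡x refl) rℓ≡s
          , λ {y} e → let (r′ , (pi , pj) , _) = orthogonal i≢j x y in
              trans (cong (λ t → array t j) (unique (pi , e))) pj
    ; column∃! = λ y s → case orthogonal j≢ℓ y s of λ where
        (r , (rj≡y , rℓ≡s) , unique) →
            array r i
          , trans (entry-row r refl rj≡y) rℓ≡s
          , λ {x} e → let (r′ , (pi , pj) , _) = orthogonal i≢j x y in
              trans (cong (λ t → array t i) (unique (pj , e))) pi
    }
    where
    i≢j : i ≢ j
    i≢j = <⇒≢ i<j

    j≢ℓ : j ≢ ℓ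
    j≢ℓ = <⇒≢ j<ℓ

    i≢ℓ : i ≢ ℓ
    i≢ℓ = <⇒≢ (<-trans i<j j<ℓ)

    entry : Λ → Λ → Λ
    entry x y = array (proj₁ (orthogonal i≢j x y)) ℓ

    entry-row : ∀ r {x y} → array r i ≡ x → array r j ≡ y → entry x y ≡ array r ℓ
    entry-row r {x} {y} p q =
      cong (λ t → array t ℓ) (proj₂ (proj₂ (orthogonal i≢j x y)) (p , q))

  ensemble : List (LatinSquare Λ)
  ensemble = map latinSquare (columnTriples k)

  equiparityCount : ℕ
  equiparityCount = length (filter (equiparity? enum) ensemble)

{-# OPTIONS --safe #-}

-- Number the symbols, and for columns c ≢ d let P(c,d) be the parity of the
-- permutation that sorts the rows lexicographically by column c, then column d.
-- Counting inverted pairs of rows gives πr = P(i,j) + P(i,ℓ), πc = P(j,i) + P(j,ℓ)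
-- and πs = P(ℓ,i) + P(ℓ,j), as well as P(c,d) + P(d,c) = C(n,2)² = 1.  So P is a
-- tournament on the n + 1 columns whose cyclic triangles are the equiparity squares.
-- As two rows agree in exactly one column, ∑_c P(c,d) does not depend on d: all
-- scores have the same parity.
--
-- Let s₀ ≤ … ≤ sₙ be the scores, and W_k = ∑_{i<k} s_i − C(k,2), which is ≥ 0 by
-- Landau.  The number T of cyclic triangles satisfies 2T = ∑ k² − ∑ s_k², and
-- summation by parts bounds this below by ∑ W_k.  Since s_k + s_{k+1} is even, W_k and
-- W_{k+2} differ by an odd number, so one of them is positive; thus n ≤ 2 ∑ W_k ≤ 4T.
module Submission where

open import Defs
open import Algebra.Bundles using (CommutativeSemiring)
import Algebra.Properties.Semiring.Sum
open import Algebra.Structures using (IsCommutativeSemiring)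
open import Data.Bool using (Bool; true; false; not; _∧_; if_then_else_)
import Data.Fin as Fin
open Fin using (Fin; zero; suc)
import Data.Fin.Properties as Fin
open import Data.List
  using (List; []; _∷_; map; mapMaybe; length; filter; tabulate; allFin; cartesianProduct)
open import Data.List.Properties using (length-tabulate; map-++; map-∘)
open import Data.List.Relation.Binary.Permutation.Propositional using (_↭_; ↭-sym; ↭⇒↭ₛ)
open import Data.List.Relation.Binary.Permutation.Propositional.Properties using (map⁺; ↭-length)
import Data.List.Relation.Binary.Permutation.Setoid.Properties as Permutation
open import Data.List.Relation.Unary.All as All using (All; []; _∷_)
open import Data.List.Relation.Unary.AllPairs using (AllPairs; []; _∷_)
open import Data.List.Relation.Unary.Sorted.TotalOrder.Properties using (Sorted⇒AllPairs)
open import Data.List.Relation.Unary.Unique.Propositional using (Unique)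
open import Data.List.Relation.Unary.Unique.Propositional.Properties using (allFin⁺)
import Data.List.Sort
open import Data.Maybe as Maybe using (Maybe; just; nothing; maybe′)
import Data.Nat
open import Data.Nat as ℕ using (ℕ; zero; suc; z≤n; s≤s)
open import Data.Nat.DivMod using (_%_; _/_; m≡m%n+[m/n]*n; m<n*o⇒m/o<n)
import Data.Nat.ListAction as ListAction
open import Data.Nat.ListAction.Properties using (sum-++; sum-↭)
import Data.Nat.Properties as ℕₚ
import Data.Nat.Tactic.RingSolver as ℕ-Solver
import Data.Parity
open import Data.Parity as ℙ using (Parity; 0ℙ; 1ℙ)
import Data.Parity.Properties as ℙ
open import Data.Product using (Σ; _×_; _,_; proj₁; proj₂)
open import Data.Sum using (_⊎_; inj₁; inj₂)
open import Function using (_∘_; id; Inverse)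
open import Level using (0ℓ)
open import Relation.Binary.Bundles using (DecTotalOrder)
import Relation.Binary.Construct.Flip.EqAndOrd as Flip
import Relation.Binary.Construct.On as On
open import Relation.Binary.Definitions using (tri<; tri≈; tri>)
open import Relation.Binary.PropositionalEquality
open import Relation.Nullary using (Dec; yes; no; does; proof; contradiction)
open import Relation.Nullary.Decidable using (_×-dec_; dec⇒maybe; dec-true; dec-false)
open import Relation.Nullary.Reflects using (Reflects; invert)
open import Relation.Unary using (Pred; Decidable)

-- Boolean order and equality on `Fin n`

infix 4 _<ᵇ_ _≡ᵇ_

_<ᵇ_ _≡ᵇ_ : ∀ {n} → Fin n → Fin n → Bool
i <ᵇ j = does (i Fin.<? j)
i ≡ᵇ j = does (i Fin.≟ j)

-- Each case carries the values of all three Boolean tests, so that one case split followed by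
-- `rewrite` evaluates every indicator built from them.
data Comparison {n} (i j : Fin n) : Set where
  less    : (i <ᵇ j) ≡ true → (i ≡ᵇ j) ≡ false → (j <ᵇ i) ≡ false → Comparison i j
  equal   : i ≡ j → (i <ᵇ j) ≡ false → (i ≡ᵇ j) ≡ true → (j <ᵇ i) ≡ false → Comparison i j
  greater : (i <ᵇ j) ≡ false → (i ≡ᵇ j) ≡ false → (j <ᵇ i) ≡ true → Comparison i j

compare : ∀ {n} (i j : Fin n) → Comparison i j
compare i j with Fin.<-cmp i j
... | tri< p ¬q ¬r = less (dec-true (i Fin.<? j) p) (dec-false (i Fin.≟ j) ¬q) (dec-false (j Fin.<? i) ¬r)
... | tri≈ ¬p q ¬r = equal q (dec-false (i Fin.<? j) ¬p) (dec-true (i Fin.≟ j) q) (dec-false (j Fin.<? i) ¬r)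
... | tri> ¬p ¬q r = greater (dec-false (i Fin.<? j) ¬p) (dec-false (i Fin.≟ j) ¬q) (dec-true (j Fin.<? i) r)

<ᵇ-sound : ∀ {n} (i j : Fin n) → (i <ᵇ j) ≡ true → i Fin.< j
<ᵇ-sound i j e = invert (subst (Reflects _) e (proof (i Fin.<? j)))

≡ᵇ-sound : ∀ {n} {i j : Fin n} → (i ≡ᵇ j) ≡ true → i ≡ j
≡ᵇ-sound {i = i} {j} e = invert (subst (Reflects _) e (proof (i Fin.≟ j)))

<ᵇ-irrefl : ∀ {n} (i : Fin n) → (i <ᵇ i) ≡ false
<ᵇ-irrefl i = dec-false (i Fin.<? i) (Fin.<-irrefl refl)

<ᵇ-trans : ∀ {n} (i j k : Fin n) → (i <ᵇ j) ≡ true → (j <ᵇ k) ≡ true → (i <ᵇ k) ≡ true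
<ᵇ-trans i j k p q = dec-true (i Fin.<? k) (Fin.<-trans (<ᵇ-sound i j p) (<ᵇ-sound j k q))

-- Finite sums of indicators in a commutative semiring, used for ℕ and for parities

module IndicatorSums {A : Set} {add mul : A → A → A} {0A 1A : A}
  (isCommutativeSemiring : IsCommutativeSemiring _≡_ add mul 0A 1A) where

  private
    R : CommutativeSemiring _ _
    R = record { isCommutativeSemiring = isCommutativeSemiring }

  open CommutativeSemiring R hiding (refl; sym; trans; zero)
  open Algebra.Properties.Semiring.Sum semiring public
  open ≡-Reasoning

  χ : Bool → A
  χ b = if b then 1# else 0#

  χ-∧ : ∀ a b → χ (a ∧ b) ≡ χ a * χ b
  χ-∧ true  b = sym (*-identityˡ _)
  χ-∧ false b = sym (zeroˡ _)

  sum-zero : ∀ {n} {f : Fin n → A} → (∀ i → f i ≡ 0#) → sum f ≡ 0#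
  sum-zero {n} f≡0 = trans (sum-cong-≗ f≡0) (sum-replicate-zero n)

  sum-cong₂ : ∀ {m n} {f g : Fin m → Fin n → A} → (∀ i j → f i j ≡ g i j) →
              ∑[ i < m ] ∑[ j < n ] f i j ≡ ∑[ i < m ] ∑[ j < n ] g i j
  sum-cong₂ h = sum-cong-≗ λ i → sum-cong-≗ (h i)

  ∑∑-distrib-+ : ∀ {m n} (f g : Fin m → Fin n → A) →
                 ∑[ i < m ] ∑[ j < n ] (f i j + g i j) ≡
                 ∑[ i < m ] ∑[ j < n ] f i j + ∑[ i < m ] ∑[ j < n ] g i j
  ∑∑-distrib-+ f g = trans (sum-cong-≗ λ i → ∑-distrib-+ (f i) (g i))
    (∑-distrib-+ (λ i → sum (f i)) (λ i → sum (g i)))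

  sum-*-sum : ∀ {m n} (f : Fin m → A) (g : Fin n → A) →
              sum f * sum g ≡ ∑[ i < m ] ∑[ j < n ] (f i * g j)
  sum-*-sum f g = trans (*-distribʳ-sum (sum g) f) (sum-cong-≗ λ i → *-distribˡ-sum (f i) g)

  sum-δ : ∀ {n} (i : Fin n) (f : Fin n → A) → ∑[ j < n ] (χ (i ≡ᵇ j) * f j) ≡ f i
  sum-δ zero    f = begin
    1# * f zero + ∑[ j < _ ] (0# * f (suc j)) ≡⟨ cong₂ _+_ (*-identityˡ _) (sum-zero λ j → zeroˡ (f (suc j))) ⟩
    f zero + 0#                             ≡⟨ +-identityʳ _ ⟩
    f zero                                  ∎
  sum-δ (suc i) f = begin
    0# * f zero + ∑[ j < _ ] (χ (i ≡ᵇ j) * f (suc j)) ≡⟨ cong₂ _+_ (zeroˡ _) (sum-δ i (f ∘ suc)) ⟩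
    0# + f (suc i)                                  ≡⟨ +-identityˡ _ ⟩
    f (suc i)                                       ∎

  -- The index square splits into the diagonal and two halves; transposing the half `j < i` merges
  -- it with the other.
  ∑∑-unordered : ∀ {n} (f : Fin n → Fin n → A) →
    ∑[ i < n ] ∑[ j < n ] f i j ≡
    ∑[ i < n ] f i i + ∑[ i < n ] ∑[ j < n ] (χ (i <ᵇ j) * (f i j + f j i))
  ∑∑-unordered {n} f = begin
    ∑[ i < n ] ∑[ j < n ] f i j
      ≡⟨ sum-cong₂ split ⟩
    ∑[ i < n ] ∑[ j < n ] (χ (i ≡ᵇ j) * f i j + (χ (i <ᵇ j) * f i j + χ (j <ᵇ i) * f i j))
      ≡⟨ ∑∑-distrib-+ {n} {n} _ _ ⟩
    ∑[ i < n ] ∑[ j < n ] (χ (i ≡ᵇ j) * f i j) +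
    ∑[ i < n ] ∑[ j < n ] (χ (i <ᵇ j) * f i j + χ (j <ᵇ i) * f i j)
      ≡⟨ cong₂ _+_ (sum-cong-≗ λ i → sum-δ i (f i)) (∑∑-distrib-+ {n} {n} _ _) ⟩
    ∑[ i < n ] f i i +
    (∑[ i < n ] ∑[ j < n ] (χ (i <ᵇ j) * f i j) + ∑[ i < n ] ∑[ j < n ] (χ (j <ᵇ i) * f i j))
      ≡⟨ cong (λ t → ∑[ i < n ] f i i + (∑[ i < n ] ∑[ j < n ] (χ (i <ᵇ j) * f i j) + t)) (∑-comm {n} {n} _) ⟩
    ∑[ i < n ] f i i +
    (∑[ i < n ] ∑[ j < n ] (χ (i <ᵇ j) * f i j) + ∑[ i < n ] ∑[ j < n ] (χ (i <ᵇ j) * f j i))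
      ≡⟨ cong (∑[ i < n ] f i i +_)
           (trans (sym (∑∑-distrib-+ {n} {n} _ _)) (sum-cong₂ {n} {n} λ i j → sym (distribˡ _ _ _))) ⟩
    ∑[ i < n ] f i i + ∑[ i < n ] ∑[ j < n ] (χ (i <ᵇ j) * (f i j + f j i)) ∎
    where
    split : ∀ i j → f i j ≡ χ (i ≡ᵇ j) * f i j + (χ (i <ᵇ j) * f i j + χ (j <ᵇ i) * f i j)
    split i j with compare i j
    ... | less p q r rewrite p | q | r | zeroˡ (f i j) | *-identityˡ (f i j)
                           | +-identityʳ (f i j) | +-identityˡ (f i j) = refl
    ... | equal _ p q r rewrite p | q | r | zeroˡ (f i j) | *-identityˡ (f i j)
                           | +-identityʳ 0# | +-identityʳ (f i j) = refl
    ... | greater p q r rewrite p | q | r | zeroˡ (f i j) | *-identityˡ (f i j)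
                           | +-identityˡ (f i j) | +-identityˡ (f i j) = refl

  -- By `fibre`, `ρ x y = r` is the same condition as `p r = x` and `q r = y`. Both sides are thus
  -- sums of `f r` over the same triples, and `sum-δ` collapses either form.
  sum-reindex : ∀ {N m n} (ρ : Fin m → Fin n → Fin N) (p : Fin N → Fin m) (q : Fin N → Fin n) →
    (∀ x y → p (ρ x y) ≡ x) → (∀ x y → q (ρ x y) ≡ y) → (∀ r → ρ (p r) (q r) ≡ r) →
    (f : Fin N → A) → sum f ≡ ∑[ x < m ] ∑[ y < n ] f (ρ x y)
  sum-reindex {N} {m} {n} ρ p q p-ρ q-ρ ρ-pq f = begin
    ∑[ r < N ] f r
      ≡⟨ sum-cong-≗ (λ r → sym (trans (sum-δ (p r) (λ x → ∑[ y < n ] (χ (q r ≡ᵇ y) * f r)))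
                                      (sum-δ (q r) (λ _ → f r)))) ⟩
    ∑[ r < N ] ∑[ x < m ] (χ (p r ≡ᵇ x) * ∑[ y < n ] (χ (q r ≡ᵇ y) * f r))
      ≡⟨ sum-cong₂ {N} {m} (λ r x → *-distribˡ-sum {n} (χ (p r ≡ᵇ x)) (λ y → χ (q r ≡ᵇ y) * f r)) ⟩
    ∑[ r < N ] ∑[ x < m ] ∑[ y < n ] (χ (p r ≡ᵇ x) * (χ (q r ≡ᵇ y) * f r))
      ≡⟨ sum-cong₂ {N} {m} (λ r x → sum-cong-≗ {n} λ y → fibre r x y) ⟩
    ∑[ r < N ] ∑[ x < m ] ∑[ y < n ] (χ (ρ x y ≡ᵇ r) * f r)
      ≡⟨ ∑-comm {N} {m} _ ⟩
    ∑[ x < m ] ∑[ r < N ] ∑[ y < n ] (χ (ρ x y ≡ᵇ r) * f r)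
      ≡⟨ sum-cong-≗ {m} (λ x → ∑-comm {N} {n} _) ⟩
    ∑[ x < m ] ∑[ y < n ] ∑[ r < N ] (χ (ρ x y ≡ᵇ r) * f r)
      ≡⟨ sum-cong₂ {m} {n} (λ x y → sum-δ (ρ x y) f) ⟩
    ∑[ x < m ] ∑[ y < n ] f (ρ x y) ∎
    where
    fibre : ∀ r x y → χ (p r ≡ᵇ x) * (χ (q r ≡ᵇ y) * f r) ≡ χ (ρ x y ≡ᵇ r) * f r
    fibre r x y with p r Fin.≟ x | q r Fin.≟ y
    ... | yes refl | yes refl rewrite dec-true (ρ (p r) (q r) Fin.≟ r) (ρ-pq r) = *-identityˡ _
    ... | yes _ | no q≢y
      rewrite dec-false (ρ x y Fin.≟ r) (λ e → q≢y (trans (cong q (sym e)) (q-ρ x y))) = *-identityˡ _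
    ... | no p≢x | _
      rewrite dec-false (ρ x y Fin.≟ r) (λ e → p≢x (trans (cong p (sym e)) (p-ρ x y)))
      = trans (zeroˡ _) (sym (zeroˡ _))

module ℕΣ = IndicatorSums ℕₚ.+-*-isCommutativeSemiring

-- C(n,2) and the sum of k² over k < n: the sums of the scores and of their squares in a transitive
-- tournament.
triangular squarePyramidal : ℕ → ℕ
triangular zero    = 0
triangular (suc n) = n ℕ.+ triangular n
squarePyramidal zero    = 0
squarePyramidal (suc n) = n ℕ.* n ℕ.+ squarePyramidal n

-- Tournaments

module TournamentCounting where
  open Data.Nat using (_+_; _*_)
  open ℕₚ using (*-zeroʳ; *-identityʳ; +-identityʳ)
  open ℕΣ

  ∑-one : ∀ n → ∑[ i < n ] 1 ≡ n
  ∑-one zero    = refl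
  ∑-one (suc n) = cong suc (∑-one n)

  ∑∑-< : ∀ n → ∑[ i < n ] ∑[ j < n ] χ (i <ᵇ j) ≡ triangular n
  ∑∑-< zero    = refl
  ∑∑-< (suc n) = cong₂ _+_ (∑-one n) (∑∑-< n)

  ascending : ∀ {m} → Fin m → Fin m → Fin m → ℕ
  ascending i j k = χ (i <ᵇ j) * χ (j <ᵇ k)

  triples : ℕ → ℕ
  triples m = ∑[ i < m ] ∑[ j < m ] ∑[ k < m ] ascending i j k

  -- Triples that start at index 0 correspond to ascending pairs of the other m indices; the
  -- remaining triples avoid index 0.
  triples-suc : ∀ m → triples (suc m) ≡ triangular m + triples m
  triples-suc m = cong₂ _+_
    (trans (cong₂ _+_ (sum-replicate-zero m)
             (sum-cong₂ {m} {m} λ j k → +-identityʳ (χ (j <ᵇ k))))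
           (∑∑-< m))
    (sum-cong-≗ {m} λ i →
      cong₂ _+_ (sum-replicate-zero m)
        (sum-cong-≗ {m} λ j → cong (_+ ∑[ k < m ] ascending i j k) (*-zeroʳ (χ (i <ᵇ j)))))

  -- As `triples m` is C(m,3), this is k² = 2 C(k,2) + k, proved in `double`, summed over k < m.
  triples-squarePyramidal : ∀ m → 2 * triples m + triangular m ≡ squarePyramidal m
  triples-squarePyramidal zero    = refl
  triples-squarePyramidal (suc m)
    rewrite triples-suc m | sym (triples-squarePyramidal m) = begin
      2 * (triangular m + triples m) + (m + triangular m)
        ≡⟨ lemma (triangular m) (triples m) m ⟩
      (2 * triangular m + m) + (2 * triples m + triangular m)
        ≡⟨ cong (_+ (2 * triples m + triangular m)) (double m) ⟩
      m * m + (2 * triples m + triangular m) ∎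
    where
    open ≡-Reasoning
    lemma : ∀ a b c → 2 * (a + b) + (c + a) ≡ (2 * a + c) + (2 * b + a)
    lemma = ℕ-Solver.solve-∀
    step : ∀ a b → 2 * (a + b) + suc a ≡ 2 * a + 1 + (2 * b + a)
    step = ℕ-Solver.solve-∀
    square : ∀ a → 2 * a + 1 + a * a ≡ suc a * suc a
    square = ℕ-Solver.solve-∀
    double : ∀ n → 2 * triangular n + n ≡ n * n
    double zero    = refl
    double (suc n) = trans (step n (triangular n))
      (trans (cong (2 * n + 1 +_) (double n)) (square n))

record IsTournament {m} (x : Fin m → Fin m → ℕ) : Set where
  field
    irreflexive : ∀ u → x u u ≡ 0
    total       : ∀ {u v} → u ≢ v → x u v ℕ.+ x v u ≡ 1

module Tournament {m} {x : Fin m → Fin m → ℕ} (isTournament : IsTournament x) where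
  open Data.Nat using (_+_; _*_)
  open ℕₚ using (*-zeroʳ; *-identityʳ; +-identityʳ)
  open ℕΣ
  open TournamentCounting
  open IsTournament isTournament
  open ≡-Reasoning

  score : Fin m → ℕ
  score u = ∑[ v < m ] x u v

  cyclic : Fin m → Fin m → Fin m → ℕ
  cyclic i j k = x i j * x j k * x k i + x i k * x k j * x j i

  cyclicTriangles : ℕ
  cyclicTriangles = ∑[ i < m ] ∑[ j < m ] ∑[ k < m ] (ascending i j k * cyclic i j k)

  private
    fork : Fin m → Fin m → Fin m → ℕ
    fork u v w = x u v * x u w

    ∑³ : (Fin m → Fin m → Fin m → ℕ) → ℕ
    ∑³ f = ∑[ i < m ] ∑[ j < m ] ∑[ k < m ] f i j k

    ∑³-cong : ∀ {f g} → (∀ i j k → f i j k ≡ g i j k) → ∑³ f ≡ ∑³ g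
    ∑³-cong h = sum-cong-≗ λ i → sum-cong₂ (h i)

    ∑³-distrib : ∀ f g → ∑³ (λ i j k → f i j k + g i j k) ≡ ∑³ f + ∑³ g
    ∑³-distrib f g = trans (sum-cong-≗ λ i → ∑∑-distrib-+ (f i) (g i)) (∑-distrib-+ {m} _ _)

  -- A transitive triangle has a unique source and a cyclic one has none. `cases` checks the eight
  -- orientations and dismisses arc values above 1.
  cyclic-or-source : ∀ {i j k} → i ≢ j → j ≢ k → k ≢ i →
                     cyclic i j k + (fork i j k + (fork j i k + fork k i j)) ≡ 1
  cyclic-or-source {i} {j} {k} i≢j j≢k k≢i =
    cases (x i j) (x j i) (x j k) (x k j) (x k i) (x i k) (total i≢j) (total j≢k) (total k≢i)
    where
    cases : ∀ a a′ b b′ c c′ → a + a′ ≡ 1 → b + b′ ≡ 1 → c + c′ ≡ 1 →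
            (a * b * c + c′ * b′ * a′) + (a * c′ + (a′ * b + c * b′)) ≡ 1
    cases 0 .1 0 .1 0 .1 refl refl refl = refl
    cases 0 .1 0 .1 1 .0 refl refl refl = refl
    cases 0 .1 1 .0 0 .1 refl refl refl = refl
    cases 0 .1 1 .0 1 .0 refl refl refl = refl
    cases 1 .0 0 .1 0 .1 refl refl refl = refl
    cases 1 .0 0 .1 1 .0 refl refl refl = refl
    cases 1 .0 1 .0 0 .1 refl refl refl = refl
    cases 1 .0 1 .0 1 .0 refl refl refl = refl
    cases (suc (suc _)) _ _ _ _ _ ()
    cases 0 .1 (suc (suc _)) _ _ _ refl ()
    cases 1 .0 (suc (suc _)) _ _ _ refl ()
    cases 0 .1 0 .1 (suc (suc _)) _ refl refl ()
    cases 0 .1 1 .0 (suc (suc _)) _ refl refl ()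
    cases 1 .0 0 .1 (suc (suc _)) _ refl refl ()
    cases 1 .0 1 .0 (suc (suc _)) _ refl refl ()

  -- If v < w, then u lies below, between or above them, in exactly one of these positions;
  -- otherwise transitivity excludes all three.
  ascending-position : ∀ {u v w : Fin m} → u ≢ v → u ≢ w →
    ascending u v w + (ascending v u w + ascending v w u) ≡ χ (v <ᵇ w)
  ascending-position {u} {v} {w} u≢v u≢w with compare u v | compare u w | v <ᵇ w in v<w
  ... | equal u≡v _ _ _ | _ | _ = contradiction u≡v u≢v
  ... | _ | equal u≡w _ _ _ | _ = contradiction u≡w u≢w
  ... | less p _ q | less r _ t | true rewrite p | q | t = refl
  ... | less p _ q | less r _ t | false rewrite p | q = refl
  ... | greater p _ q | less r _ t | true rewrite p | q | r | t = refl
  ... | greater p _ q | less r _ t | false =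
    contradiction (trans (sym v<w) (<ᵇ-trans v u w q r)) λ ()
  ... | less p _ q | greater r _ t | true =
    contradiction (trans (sym (<ᵇ-trans u v w p v<w)) r) λ ()
  ... | less p _ q | greater r _ t | false rewrite p | q = refl
  ... | greater p _ q | greater r _ t | true rewrite p | q | r | t = refl
  ... | greater p _ q | greater r _ t | false rewrite p | q | r = refl

  fork-position : ∀ u v w →
    ascending u v w * fork u v w + (ascending v u w * fork u v w + ascending v w u * fork u v w)
    ≡ χ (v <ᵇ w) * fork u v w
  fork-position u v w with u Fin.≟ v | u Fin.≟ w
  ... | no u≢v | no u≢w =
    trans (factor (ascending u v w) (ascending v u w) (ascending v w u) (fork u v w))
          (cong (_* fork u v w) (ascending-position u≢v u≢w))
    where
    factor : ∀ a b c d → a * d + (b * d + c * d) ≡ (a + (b + c)) * d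
    factor = ℕ-Solver.solve-∀
  ... | yes refl | _ rewrite irreflexive u | *-zeroʳ (ascending u u w) | *-zeroʳ (ascending u w u) =
    sym (*-zeroʳ (χ (u <ᵇ w)))
  ... | no _ | yes refl rewrite irreflexive u | *-zeroʳ (x u v) | *-zeroʳ (ascending u v u)
                              | *-zeroʳ (ascending v u u) | *-zeroʳ (χ (v <ᵇ u)) = refl

  -- A triple that is not cyclic is counted through its source, which may be its first, second or
  -- third vertex. Renaming the source to u merges the three sums into one over u and the pairs v <
  -- w.
  triples≡cyclic+forks :
    triples m ≡ cyclicTriangles + ∑³ (λ u v w → χ (v <ᵇ w) * fork u v w)
  triples≡cyclic+forks = begin
    ∑³ ascending
      ≡⟨ ∑³-cong expand ⟩
    ∑³ (λ i j k → cyc i j k + (f₁ i j k + (f₂ i j k + f₃ i j k)))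
      ≡⟨ trans (∑³-distrib cyc _) (cong (cyclicTriangles +_)
           (trans (∑³-distrib f₁ _) (cong (∑³ f₁ +_) (∑³-distrib f₂ f₃)))) ⟩
    cyclicTriangles + (∑³ f₁ + (∑³ f₂ + ∑³ f₃))
      ≡⟨ cong (λ t → cyclicTriangles + (∑³ f₁ + t)) (cong₂ _+_ swap₂ swap₃) ⟩
    cyclicTriangles + (∑³ f₁ + (∑³ (λ u v w → f₂ v u w) + ∑³ (λ u v w → f₃ v w u)))
      ≡⟨ cong (cyclicTriangles +_) (sym (trans (∑³-distrib f₁ _)
           (cong (∑³ f₁ +_) (∑³-distrib (λ u v w → f₂ v u w) _)))) ⟩
    cyclicTriangles + ∑³ (λ u v w → f₁ u v w + (f₂ v u w + f₃ v w u))
      ≡⟨ cong (cyclicTriangles +_) (∑³-cong fork-position) ⟩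
    cyclicTriangles + ∑³ (λ u v w → χ (v <ᵇ w) * fork u v w) ∎
    where
    cyc f₁ f₂ f₃ : Fin m → Fin m → Fin m → ℕ
    cyc i j k = ascending i j k * cyclic i j k
    f₁ i j k = ascending i j k * fork i j k
    f₂ i j k = ascending i j k * fork j i k
    f₃ i j k = ascending i j k * fork k i j

    distribute : ∀ a b c d e → a * b + (a * c + (a * d + a * e)) ≡ a * (b + (c + (d + e)))
    distribute = ℕ-Solver.solve-∀

    expand : ∀ i j k → ascending i j k ≡ cyc i j k + (f₁ i j k + (f₂ i j k + f₃ i j k))
    expand i j k with compare i j | compare j k
    ... | less p i≢j _ | less q j≢k _ = begin
      ascending i j k
        ≡⟨ sym (*-identityʳ _) ⟩
      ascending i j k * 1
        ≡⟨ cong (ascending i j k *_) (sym (cyclic-or-source (Fin.<⇒≢ i<j) (Fin.<⇒≢ j<k)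
             (Fin.<⇒≢ (Fin.<-trans i<j j<k) ∘ sym))) ⟩
      ascending i j k * (cyclic i j k + (fork i j k + (fork j i k + fork k i j)))
        ≡⟨ sym (distribute (ascending i j k) (cyclic i j k) (fork i j k) (fork j i k) (fork k i j)) ⟩
      cyc i j k + (f₁ i j k + (f₂ i j k + f₃ i j k)) ∎
      where
      i<j = <ᵇ-sound i j p
      j<k = <ᵇ-sound j k q
    ... | equal _ p _ _ | _ rewrite p = refl
    ... | greater p _ _ | _ rewrite p = refl
    ... | less p _ _ | equal _ q _ _ rewrite p | q = refl
    ... | less p _ _ | greater q _ _ rewrite p | q = refl

    swap₂ : ∑³ f₂ ≡ ∑³ (λ u v w → f₂ v u w)
    swap₂ = ∑-comm {m} {m} _

    swap₃ : ∑³ f₃ ≡ ∑³ (λ u v w → f₃ v w u)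
    swap₃ = trans (sum-cong-≗ λ i → ∑-comm (f₃ i)) (∑-comm {m} {m} _)

  -- The diagonal of the expanded square gives the score back, because 0 and 1 are their own
  -- squares.
  score²≡score+forks : ∀ u →
    score u * score u ≡ score u + 2 * ∑[ v < m ] ∑[ w < m ] (χ (v <ᵇ w) * fork u v w)
  score²≡score+forks u = begin
    score u * score u
      ≡⟨ sum-*-sum (x u) (x u) ⟩
    ∑[ v < m ] ∑[ w < m ] (x u v * x u w)
      ≡⟨ ∑∑-unordered (λ v w → x u v * x u w) ⟩
    ∑[ v < m ] (x u v * x u v) + ∑[ v < m ] ∑[ w < m ] (χ (v <ᵇ w) * (fork u v w + fork u w v))
      ≡⟨ cong₂ _+_ (sum-cong-≗ idempotent) (trans (sum-cong₂ double)
           (sym (trans (*-distribˡ-sum 2 (λ v → ∑[ w < m ] (χ (v <ᵇ w) * fork u v w)))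
                       (sum-cong-≗ λ v → *-distribˡ-sum 2 (λ w → χ (v <ᵇ w) * fork u v w))))) ⟩
    score u + 2 * ∑[ v < m ] ∑[ w < m ] (χ (v <ᵇ w) * fork u v w) ∎
    where
    0-or-1 : ∀ a b → a + b ≡ 1 → a * a ≡ a
    0-or-1 0 _ _ = refl
    0-or-1 1 _ _ = refl
    0-or-1 (suc (suc _)) _ ()

    idempotent : ∀ v → x u v * x u v ≡ x u v
    idempotent v with u Fin.≟ v
    ... | yes refl rewrite irreflexive u = refl
    ... | no u≢v = 0-or-1 (x u v) (x v u) (total u≢v)

    twice : ∀ a b c → a * (b * c + c * b) ≡ 2 * (a * (b * c))
    twice = ℕ-Solver.solve-∀

    double : ∀ v w → χ (v <ᵇ w) * (fork u v w + fork u w v) ≡ 2 * (χ (v <ᵇ w) * fork u v w)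
    double v w = twice (χ (v <ᵇ w)) (x u v) (x u w)

  -- Eliminating the number of forks between `score²≡score+forks` and `triples≡cyclic+forks` leaves
  -- 2 C(m,3) + C(m,2).
  2cyclic+∑score² : ∑[ u < m ] score u ≡ triangular m →
    2 * cyclicTriangles + ∑[ u < m ] (score u * score u) ≡ squarePyramidal m
  2cyclic+∑score² ∑score = begin
    2 * cyclicTriangles + ∑[ u < m ] (score u * score u)
      ≡⟨ cong (2 * cyclicTriangles +_) (trans (sum-cong-≗ score²≡score+forks)
           (trans (∑-distrib-+ score _) (cong (∑[ u < m ] score u +_) (sym (*-distribˡ-sum 2 forks))))) ⟩
    2 * cyclicTriangles + (∑[ u < m ] score u + 2 * sum forks)
      ≡⟨ regroup cyclicTriangles (sum score) (sum forks) ⟩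
    2 * (cyclicTriangles + sum forks) + ∑[ u < m ] score u
      ≡⟨ cong₂ (λ a b → 2 * a + b) (sym triples≡cyclic+forks) ∑score ⟩
    2 * triples m + triangular m
      ≡⟨ triples-squarePyramidal m ⟩
    squarePyramidal m ∎
    where
    forks : Fin m → ℕ
    forks u = ∑[ v < m ] ∑[ w < m ] (χ (v <ᵇ w) * fork u v w)

    regroup : ∀ a b c → 2 * a + (b + 2 * c) ≡ 2 * (a + c) + b
    regroup = ℕ-Solver.solve-∀

-- Sums over lists

module Lists where
  open Data.Nat using (_+_; _*_; _≤_)
  open ℕₚ using (+-monoʳ-≤; +-identityʳ)
  open ℕΣ using (χ; sum-δ; ∑-distrib-+; sum-cong-≗; sum-syntax)

  ∑ : {A : Set} → (A → ℕ) → List A → ℕ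
  ∑ f xs = ListAction.sum (map f xs)

  ∑-distrib : {A : Set} (f g : A → ℕ) (xs : List A) → ∑ (λ a → f a + g a) xs ≡ ∑ f xs + ∑ g xs
  ∑-distrib f g []       = refl
  ∑-distrib f g (a ∷ xs) rewrite ∑-distrib f g xs = exchange (f a) (g a) (∑ f xs) (∑ g xs)
    where
    exchange : ∀ a b c d → a + b + (c + d) ≡ a + c + (b + d)
    exchange = ℕ-Solver.solve-∀

  ∑-cong : {A : Set} {f g : A → ℕ} {xs : List A} → All (λ a → f a ≡ g a) xs → ∑ f xs ≡ ∑ g xs
  ∑-cong []       = refl
  ∑-cong (e ∷ es) = cong₂ _+_ e (∑-cong es)

  ∑-mono : {A : Set} {f g : A → ℕ} → (∀ a → f a ≤ g a) → (xs : List A) → ∑ f xs ≤ ∑ g xs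
  ∑-mono h []       = z≤n
  ∑-mono h (a ∷ xs) = ℕₚ.+-mono-≤ (h a) (∑-mono h xs)

  ∑-↭ : {A : Set} (f : A → ℕ) {xs ys : List A} → xs ↭ ys → ∑ f xs ≡ ∑ f ys
  ∑-↭ f p = sum-↭ (map⁺ f p)

  ∑-tabulate : ∀ {n} {A : Set} (f : A → ℕ) (g : Fin n → A) → ∑ f (tabulate g) ≡ ℕΣ.sum (f ∘ g)
  ∑-tabulate {zero}  f g = refl
  ∑-tabulate {suc n} f g = cong (f (g zero) +_) (∑-tabulate f (g ∘ suc))

  -- Induction with `f` varying: for the tail, `f` gives way to `rest`, which vanishes at `u` and
  -- agrees with `f` on the tail because `u` does not recur there.
  ∑-Unique≤sum : ∀ {m} (f : Fin m → ℕ) {us} → Unique us → ∑ f us ≤ ℕΣ.sum f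
  ∑-Unique≤sum f [] = z≤n
  ∑-Unique≤sum {m} f {u ∷ us} (u∉us ∷ unique) = begin
    f u + ∑ f us      ≡⟨ cong (f u +_) (∑-cong (All.map keep u∉us)) ⟩
    f u + ∑ rest us   ≤⟨ +-monoʳ-≤ (f u) (∑-Unique≤sum rest unique) ⟩
    f u + ℕΣ.sum rest ≡⟨ cong (_+ ℕΣ.sum rest) (sym (sum-δ u f)) ⟩
    ∑[ v < m ] (χ (u ≡ᵇ v) * f v) + ℕΣ.sum rest
                      ≡⟨ sym (∑-distrib-+ (λ v → χ (u ≡ᵇ v) * f v) rest) ⟩
    ∑[ v < m ] (χ (u ≡ᵇ v) * f v + rest v)
                      ≡⟨ sum-cong-≗ split ⟩
    ℕΣ.sum f          ∎
    where
    open ℕₚ.≤-Reasoning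

    rest : Fin m → ℕ
    rest v = χ (not (u ≡ᵇ v)) * f v

    keep : ∀ {v} → u ≢ v → f v ≡ rest v
    keep {v} u≢v rewrite dec-false (u Fin.≟ v) u≢v = sym (+-identityʳ (f v))

    split : ∀ v → χ (u ≡ᵇ v) * f v + rest v ≡ f v
    split v with u ≡ᵇ v
    ... | true  = trans (+-identityʳ _) (+-identityʳ _)
    ... | false = +-identityʳ _

-- Landau's inequality and the score sequence

module ScoreSequence {m} {x : Fin m → Fin m → ℕ} (isTournament : IsTournament x) where
  open Data.Nat using (_+_; _*_; _∸_; _≤_; _≥_)
  open ℕₚ
  open IsTournament isTournament
  open Tournament isTournament
  open Lists

  -- A new head `u` brings exactly one arc for each vertex of `us`, in one direction or the other,
  -- and no loop.
  ∑∑-Unique : ∀ {us} → Unique us → ∑ (λ u → ∑ (x u) us) us ≡ triangular (length us)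
  ∑∑-Unique [] = refl
  ∑∑-Unique {u ∷ us} (u∉us ∷ unique) = begin
    x u u + ∑ (x u) us + ∑ (λ v → x v u + ∑ (x v) us) us
      ≡⟨ cong₂ (λ a b → a + ∑ (x u) us + b) (irreflexive u) (∑-distrib (λ v → x v u) _ us) ⟩
    ∑ (x u) us + (∑ (λ v → x v u) us + ∑ (λ v → ∑ (x v) us) us)
      ≡⟨ sym (+-assoc (∑ (x u) us) _ _) ⟩
    ∑ (x u) us + ∑ (λ v → x v u) us + ∑ (λ v → ∑ (x v) us) us
      ≡⟨ cong₂ _+_ (trans (sym (∑-distrib (x u) (λ v → x v u) us)) (∑-one u∉us)) (∑∑-Unique unique) ⟩
    length us + triangular (length us) ∎
    where
    open ≡-Reasoning
    ∑-one : ∀ {vs} → All (u ≢_) vs → ∑ (λ v → x u v + x v u) vs ≡ length vs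
    ∑-one []         = refl
    ∑-one (u≢v ∷ vs) = cong₂ _+_ (total u≢v) (∑-one vs)

  -- Every arc inside `us` is counted in the score of its winner.
  landau : ∀ {us} → Unique us → triangular (length us) ≤ ∑ score us
  landau {us} unique =
    subst (_≤ ∑ score us) (∑∑-Unique unique) (∑-mono (λ u → ∑-Unique≤sum (x u) unique) us)

  ∑-score : ℕΣ.sum score ≡ triangular m
  ∑-score = begin
    ℕΣ.sum score                                         ≡⟨ ℕΣ.sum-cong-≗ (λ u → sym (∑-tabulate (x u) id)) ⟩
    ℕΣ.sum (λ u → ∑ (x u) (allFin m))                    ≡⟨ sym (∑-tabulate (λ u → ∑ (x u) (allFin m)) id) ⟩
    ∑ (λ u → ∑ (x u) (allFin m)) (allFin m)              ≡⟨ ∑∑-Unique (allFin⁺ m) ⟩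
    triangular (length (allFin m))                       ≡⟨ cong triangular (length-tabulate {n = m} id) ⟩
    triangular m                                         ∎
    where open ≡-Reasoning

  -- W_k of the header, for the list of the k vertices of lowest score.
  excess : List (Fin m) → ℕ
  excess us = ∑ score us ∸ triangular (length us)

  -- The increment of W_k is s_k - k, written without subtraction; `landau` makes the truncated
  -- differences in `excess` exact.
  excess-∷ : ∀ {u us} → Unique (u ∷ us) → excess (u ∷ us) + length us ≡ excess us + score u
  excess-∷ {u} {us} unique@(_ ∷ unique′) = +-cancelʳ-≡ t _ _ (begin
    excess (u ∷ us) + length us + t   ≡⟨ +-assoc (excess (u ∷ us)) _ _ ⟩
    excess (u ∷ us) + (length us + t) ≡⟨ m∸n+n≡m (landau unique) ⟩
    score u + ∑ score us              ≡⟨ cong (score u +_) (sym (m∸n+n≡m (landau unique′))) ⟩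
    score u + (excess us + t)         ≡⟨ exchange (score u) (excess us) t ⟩
    excess us + score u + t           ∎)
    where
    open ≡-Reasoning
    t = triangular (length us)
    exchange : ∀ a b c → a + (b + c) ≡ b + a + c
    exchange = ℕ-Solver.solve-∀

  -- For a list in order of decreasing score the suffixes hold the lowest scores, so this is the sum
  -- of the W_k for 1 ≤ k ≤ `length us`.
  totalExcess : List (Fin m) → ℕ
  totalExcess []       = 0
  totalExcess (u ∷ us) = excess (u ∷ us) + totalExcess us

  -- Induction in which the score of the head serves as the bound `t` for the tail. The last product
  -- is the boundary term of the summation by parts; it disappears when the whole list has excess 0.
  ∑score²+totalExcess≤ : ∀ {us} t → Unique us → AllPairs (λ u v → score u ≥ score v) us →
    All (λ u → t ≥ score u) us →
    ∑ (λ u → score u * score u) us + totalExcess us ≤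
    squarePyramidal (length us) + excess us * (length us + t)
  ∑score²+totalExcess≤ t [] _ _ = z≤n
  ∑score²+totalExcess≤ {u ∷ us} t unique@(_ ∷ unique′) (u≥ ∷ sorted) (t≥u ∷ _) = begin
    (s * s + q) + (e′ + totalExcess us)          ≡⟨ regroup s q e′ (totalExcess us) ⟩
    (q + totalExcess us) + (s * s + e′)          ≤⟨ +-monoˡ-≤ _ (∑score²+totalExcess≤ s unique′ sorted u≥) ⟩
    squarePyramidal l + e * (l + s) + (s * s + e′)
      ≡⟨ +-assoc-outer (squarePyramidal l) (e * (l + s)) (s * s) e′ ⟩
    squarePyramidal l + ((e * (l + s) + s * s) + e′)
      ≡⟨ cong (λ a → squarePyramidal l + (a + e′)) (summation-by-parts (excess-∷ unique)) ⟩
    squarePyramidal l + ((e′ * (l + s) + l * l) + e′)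
      ≡⟨ collect (squarePyramidal l) e′ l s ⟩
    l * l + squarePyramidal l + e′ * (suc l + s)
      ≤⟨ +-monoʳ-≤ (l * l + squarePyramidal l) (*-monoʳ-≤ e′ (+-monoʳ-≤ (suc l) t≥u)) ⟩
    l * l + squarePyramidal l + e′ * (suc l + t) ∎
    where
    open ≤-Reasoning
    s = score u
    l = length us
    e = excess us
    e′ = excess (u ∷ us)
    q = ∑ (λ u → score u * score u) us

    regroup : ∀ s q e t → (s * s + q) + (e + t) ≡ (q + t) + (s * s + e)
    regroup = ℕ-Solver.solve-∀
    +-assoc-outer : ∀ a b c d → a + b + (c + d) ≡ a + ((b + c) + d)
    +-assoc-outer = ℕ-Solver.solve-∀
    collect : ∀ p e l s → p + ((e * (l + s) + l * l) + e) ≡ l * l + p + e * (suc l + s)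
    collect = ℕ-Solver.solve-∀
    expandˡ : ∀ e l s → e * (l + s) + s * s + s * l ≡ (e + s) * (l + s)
    expandˡ = ℕ-Solver.solve-∀
    expandʳ : ∀ e l s → (e + l) * (l + s) ≡ e * (l + s) + l * l + s * l
    expandʳ = ℕ-Solver.solve-∀

    -- In essence s² - l² = (s - l)(s + l) = (e′ - e)(l + s); adding s l to both sides avoids
    -- subtraction.
    summation-by-parts : e′ + l ≡ e + s → e * (l + s) + s * s ≡ e′ * (l + s) + l * l
    summation-by-parts eq = +-cancelʳ-≡ (s * l) _ _
      (trans (expandˡ e l s) (trans (cong (_* (l + s)) (sym eq)) (expandʳ e′ l s)))

  module SameParity (sameParity : ∀ u v → ℕ.parity (score u) ≡ ℕ.parity (score v)) where

    -- If both excesses vanish, the scores of u and v add up to 2 (length us) + 1.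
    excess-pair : ∀ {u v us} → Unique (u ∷ v ∷ us) → 1 ≤ excess us + excess (u ∷ v ∷ us)
    excess-pair {u} {v} {us} unique@(_ ∷ unique′)
      with excess us | excess (u ∷ v ∷ us) | excess-∷ unique | excess-∷ unique′
    ... | suc _ | _     | _  | _  = s≤s z≤n
    ... | zero  | suc _ | _  | _  = s≤s z≤n
    ... | zero  | zero  | p  | q  = contradiction even≡odd λ ()
      where
      open ≡-Reasoning
      l = length us
      odd : ∀ l → ℕ.parity (suc l + l) ≡ 1ℙ
      odd zero    = refl
      odd (suc l) = trans (cong ℕ.parity (+-suc l l)) (odd l)
      even≡odd : 0ℙ ≡ 1ℙ
      even≡odd = begin
        0ℙ                                             ≡⟨ sym (ℙ.p+p≡0ℙ (ℕ.parity (score u))) ⟩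
        ℕ.parity (score u) ℙ.+ ℕ.parity (score u)      ≡⟨ cong (ℕ.parity (score u) ℙ.+_) (sameParity u v) ⟩
        ℕ.parity (score u) ℙ.+ ℕ.parity (score v)      ≡⟨ sym (ℙ.+-homo-+ (score u) (score v)) ⟩
        ℕ.parity (score u + score v)                   ≡⟨ cong (λ a → ℕ.parity (score u + a)) (sym q) ⟩
        ℕ.parity (score u + (excess (v ∷ us) + l))     ≡⟨ cong ℕ.parity (exchange (score u) (excess (v ∷ us)) l) ⟩
        ℕ.parity (excess (v ∷ us) + score u + l)       ≡⟨ cong (λ a → ℕ.parity (a + l)) (sym p) ⟩
        ℕ.parity (suc l + l)                           ≡⟨ odd l ⟩
        1ℙ                                             ∎
        where
        exchange : ∀ a b c → a + (b + c) ≡ b + a + c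
        exchange = ℕ-Solver.solve-∀

    -- Adds up the inequalities W_k + W_{k+2} ≥ 1 given by `excess-pair`. The terms `excess us` and
    -- `excess (u ∷ us)` are the correction at the upper end that lets the induction close.
    length≤2totalExcess : ∀ {u us} → Unique (u ∷ us) →
      length us + excess us ≤ 2 * totalExcess us + excess (u ∷ us)
    length≤2totalExcess {us = []} _ = z≤n
    length≤2totalExcess {u} {v ∷ us} unique@(_ ∷ unique′) = begin
      suc l + e₁                       ≤⟨ +-monoˡ-≤ (l + e₁) (excess-pair unique) ⟩
      e₀ + e₂ + (l + e₁)               ≡⟨ regroup₁ e₀ e₁ e₂ l ⟩
      (l + e₀) + (e₁ + e₂)             ≤⟨ +-monoˡ-≤ (e₁ + e₂) (length≤2totalExcess unique′) ⟩
      (2 * totalExcess us + e₁) + (e₁ + e₂) ≡⟨ regroup₂ (totalExcess us) e₁ e₂ ⟩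
      2 * (e₁ + totalExcess us) + e₂   ∎
      where
      open ≤-Reasoning
      l = length us
      e₀ = excess us
      e₁ = excess (v ∷ us)
      e₂ = excess (u ∷ v ∷ us)
      regroup₁ : ∀ a b c l → a + c + (l + b) ≡ (l + a) + (b + c)
      regroup₁ = ℕ-Solver.solve-∀
      regroup₂ : ∀ t b c → (2 * t + b) + (b + c) ≡ 2 * (b + t) + c
      regroup₂ = ℕ-Solver.solve-∀

    descending : DecTotalOrder _ _ _
    descending = On.decTotalOrder (Flip.decTotalOrder ≤-decTotalOrder) score

    open Data.List.Sort descending using (sort; sort-↭; sort-↗)

    vertices : List (Fin m)
    vertices = sort (allFin m)

    vertices↭ : vertices ↭ allFin m
    vertices↭ = sort-↭ (allFin m)

    vertices-Unique : Unique vertices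
    vertices-Unique =
      Permutation.Unique-resp-↭ (setoid (Fin m)) (↭⇒↭ₛ (↭-sym vertices↭)) (allFin⁺ m)

    vertices-sorted : AllPairs (λ u v → score u ≥ score v) vertices
    vertices-sorted = Sorted⇒AllPairs (DecTotalOrder.totalOrder descending) (sort-↗ (allFin m))

    length-vertices : length vertices ≡ m
    length-vertices = trans (↭-length vertices↭) (length-tabulate id)

    ∑-vertices : ∀ f → ∑ f vertices ≡ ℕΣ.sum f
    ∑-vertices f = trans (∑-↭ f vertices↭) (∑-tabulate f id)

    excess-vertices : excess vertices ≡ 0
    excess-vertices rewrite length-vertices | ∑-vertices score | ∑-score = n∸n≡0 (triangular m)

    -- Stated for any list so that it can be split into head and tail, which `vertices` does not
    -- allow. The `suc` accounts for the head: `length≤2totalExcess` bounds the length of the tail.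
    bound : ∀ {us} → Unique us → AllPairs (λ u v → score u ≥ score v) us → excess us ≡ 0 →
      length us ≤ suc (2 * totalExcess us) ×
      ∑ (λ u → score u * score u) us + totalExcess us ≤ squarePyramidal (length us)
    bound [] _ _ = z≤n , z≤n
    bound {u ∷ us} unique sorted@(u≥ ∷ _) e≡0 = s≤s half , abel
      where
      open ≤-Reasoning
      half : length us ≤ 2 * totalExcess (u ∷ us)
      half = begin
        length us                            ≤⟨ m≤m+n _ _ ⟩
        length us + excess us                ≤⟨ length≤2totalExcess unique ⟩
        2 * totalExcess us + excess (u ∷ us) ≡⟨ cong (2 * totalExcess us +_) e≡0 ⟩
        2 * totalExcess us + 0               ≡⟨ +-identityʳ _ ⟩
        2 * totalExcess us                   ≤⟨ *-monoʳ-≤ 2 (m≤n+m _ (excess (u ∷ us))) ⟩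
        2 * totalExcess (u ∷ us)             ∎
      abel : ∑ (λ u → score u * score u) (u ∷ us) + totalExcess (u ∷ us) ≤
             squarePyramidal (length (u ∷ us))
      abel = begin
        ∑ (λ u → score u * score u) (u ∷ us) + totalExcess (u ∷ us)
          ≤⟨ ∑score²+totalExcess≤ (score u) unique sorted (≤-refl ∷ u≥) ⟩
        squarePyramidal l + excess (u ∷ us) * (l + score u)
          ≡⟨ cong (λ a → squarePyramidal l + a * (l + score u)) e≡0 ⟩
        squarePyramidal l + 0
          ≡⟨ +-identityʳ _ ⟩
        squarePyramidal l ∎
        where l = length (u ∷ us)

    -- Comparing ∑ s² + ∑ W_k ≤ ∑ k² with the identity 2T + ∑ s² = ∑ k² gives ∑ W_k ≤ 2T.
    vertices≤4cyclic : m ≤ suc (4 * cyclicTriangles)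
    vertices≤4cyclic with bound vertices-Unique vertices-sorted excess-vertices
    ... | half , abel rewrite length-vertices | ∑-vertices (λ u → score u * score u) = begin
      m                                ≤⟨ half ⟩
      suc (2 * totalExcess vertices)   ≤⟨ s≤s (*-monoʳ-≤ 2 excess≤) ⟩
      suc (2 * (2 * cyclicTriangles))  ≡⟨ cong suc (sym (*-assoc 2 2 cyclicTriangles)) ⟩
      suc (4 * cyclicTriangles)        ∎
      where
      open ≤-Reasoning
      excess≤ : totalExcess vertices ≤ 2 * cyclicTriangles
      excess≤ = +-cancelˡ-≤ (ℕΣ.sum (λ u → score u * score u)) _ _ (begin
        ℕΣ.sum (λ u → score u * score u) + totalExcess vertices ≤⟨ abel ⟩
        squarePyramidal m                                       ≡⟨ sym (2cyclic+∑score² ∑-score) ⟩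
        2 * cyclicTriangles + ℕΣ.sum (λ u → score u * score u)  ≡⟨ +-comm (2 * cyclicTriangles) _ ⟩
        ℕΣ.sum (λ u → score u * score u) + 2 * cyclicTriangles  ∎)

-- Inversions between the rows of an array

module ℙΣ = IndicatorSums ℙ.+-*-isCommutativeSemiring

≡ᵇ-sym : ∀ {n} (i j : Fin n) → (i ≡ᵇ j) ≡ (j ≡ᵇ i)
≡ᵇ-sym i j with i Fin.≟ j
... | yes i≡j = sym (dec-true (j Fin.≟ i) (sym i≡j))
... | no i≢j  = sym (dec-false (j Fin.≟ i) (i≢j ∘ sym))

parity-sum : ∀ {n} (f : Fin n → ℕ) → ℕ.parity (ℕΣ.sum f) ≡ ℙΣ.sum (ℕ.parity ∘ f)
parity-sum {zero}  f = refl
parity-sum {suc n} f =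
  trans (ℙ.+-homo-+ (f zero) _) (cong (ℕ.parity (f zero) ℙ.+_) (parity-sum (f ∘ suc)))

parity-χ : ∀ b → ℕ.parity (ℕΣ.χ b) ≡ ℙΣ.χ b
parity-χ true  = refl
parity-χ false = refl

parity-sum-χ : ∀ {n} (b : Fin n → Bool) → ℕ.parity (ℕΣ.sum (ℕΣ.χ ∘ b)) ≡ ℙΣ.sum (ℙΣ.χ ∘ b)
parity-sum-χ b = trans (parity-sum (ℕΣ.χ ∘ b)) (ℙΣ.sum-cong-≗ (parity-χ ∘ b))

module NatSumBounds where
  open Data.Nat using (_+_; _≤_)
  open ℕΣ

  sum-mono : ∀ {n} {f g : Fin n → ℕ} → (∀ i → f i ≤ g i) → sum f ≤ sum g
  sum-mono {zero}  h = z≤n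
  sum-mono {suc n} h = ℕₚ.+-mono-≤ (h zero) (sum-mono (h ∘ suc))

  -- Turns a bound that is attained in total into one attained by every term, as `agreements≡1`
  -- requires.
  ≤∧sum≡⇒≗ : ∀ {n} {f g : Fin n → ℕ} → (∀ i → f i ≤ g i) → sum f ≡ sum g → f ≗ g
  ≤∧sum≡⇒≗ {suc n} {f} {g} h e = λ where
      zero    → head≡
      (suc i) → ≤∧sum≡⇒≗ (h ∘ suc) tail≡ i
    where
    open ℕₚ.≤-Reasoning
    head≡ : f zero ≡ g zero
    head≡ = ℕₚ.≤-antisym (h zero) (ℕₚ.+-cancelʳ-≤ (sum (g ∘ suc)) _ _ (begin
      g zero + sum (g ∘ suc) ≡⟨ sym e ⟩
      f zero + sum (f ∘ suc) ≤⟨ ℕₚ.+-monoʳ-≤ (f zero) (sum-mono (h ∘ suc)) ⟩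
      f zero + sum (g ∘ suc) ∎))
    tail≡ : sum (f ∘ suc) ≡ sum (g ∘ suc)
    tail≡ = ℕₚ.+-cancelˡ-≡ (f zero) _ _ (trans e (cong (_+ sum (g ∘ suc)) (sym head≡)))

  sum-χ≤1 : ∀ {n} (b : Fin n → Bool) →
            (∀ {i j} → b i ≡ true → b j ≡ true → i ≡ j) → sum (χ ∘ b) ≤ 1
  sum-χ≤1 {zero}  b unique = z≤n
  sum-χ≤1 {suc n} b unique with b zero in eq
  ... | false = sum-χ≤1 (b ∘ suc) (λ p q → Fin.suc-injective (unique p q))
  ... | true  = s≤s (ℕₚ.≤-reflexive (sum-zero rest))
    where
    rest : ∀ i → χ (b (suc i)) ≡ 0
    rest i with b (suc i) in eq′
    ... | false = refl
    ... | true  = contradiction (unique eq eq′) λ ()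

-- The symbols are numbered: b r c is the number of the entry in row r and column c.
module Array {N n k : ℕ} (b : Fin N → Fin k → Fin n)
  (row : ∀ {c d} → c ≢ d → Fin n → Fin n → Fin N)
  (row-fst : ∀ {c d} (c≢d : c ≢ d) x y → b (row c≢d x y) c ≡ x)
  (row-snd : ∀ {c d} (c≢d : c ≢ d) x y → b (row c≢d x y) d ≡ y)
  (row-unique : ∀ {c d} → c ≢ d → ∀ {r r′} → b r c ≡ b r′ c → b r d ≡ b r′ d → r ≡ r′)
  where

  -- Agreements between two rows

  module Agreement (k≡1+n : k ≡ suc n) (N≡n*n : N ≡ n ℕ.* n) (1≤n : 1 ℕ.≤ n) where
    open Data.Nat using (_+_; _*_; _≤_)
    open ℕΣ
    open TournamentCounting using (∑-one)
    open NatSumBounds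

    agreements : Fin N → Fin N → ℕ
    agreements r r′ = ∑[ c < k ] χ (b r c ≡ᵇ b r′ c)

    another : (c : Fin k) → Σ (Fin k) (c ≢_)
    another = go k≡1+n 1≤n
      where
      go : ∀ {k n} → k ≡ suc n → 1 ≤ n → (c : Fin k) → Σ (Fin k) (c ≢_)
      go refl (s≤s _) c = Fin.punchIn c zero , (Fin.punchInᵢ≢i c zero ∘ sym)

    -- Rows are reindexed by their entries x in column `c` and y in `another` column; agreement
    -- fixes x and leaves n choices of y.
    ∑-agree-at : ∀ r c → ∑[ r′ < N ] χ (b r c ≡ᵇ b r′ c) ≡ n
    ∑-agree-at r c = begin
      ∑[ r′ < N ] χ (b r c ≡ᵇ b r′ c)
        ≡⟨ ℕΣ.sum-reindex (row c≢d) (λ r → b r c) (λ r → b r d) (row-fst c≢d) (row-snd c≢d)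
             (λ r → row-unique c≢d (row-fst c≢d _ _) (row-snd c≢d _ _)) _ ⟩
      ∑[ x < n ] ∑[ y < n ] χ (b r c ≡ᵇ b (row c≢d x y) c)
        ≡⟨ sum-cong₂ {n} {n} (λ x y → cong (λ a → χ (b r c ≡ᵇ a)) (row-fst c≢d x y)) ⟩
      ∑[ x < n ] ∑[ y < n ] χ (b r c ≡ᵇ x)
        ≡⟨ ∑-comm {n} {n} _ ⟩
      ∑[ y < n ] ∑[ x < n ] χ (b r c ≡ᵇ x)
        ≡⟨ sum-cong-≗ {n} (λ y → trans (sum-cong-≗ {n} λ x → sym (ℕₚ.*-identityʳ _))
                                       (sum-δ (b r c) (λ _ → 1))) ⟩
      ∑[ y < n ] 1
        ≡⟨ ∑-one n ⟩
      n ∎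
      where
      open ≡-Reasoning
      d = proj₁ (another c)
      c≢d = proj₂ (another c)

    ∑-agreements : ∀ r → ∑[ r′ < N ] agreements r r′ ≡ k * n
    ∑-agreements r = trans (∑-comm {N} {k} _) (trans (sum-cong-≗ (∑-agree-at r)) (const-sum k))
      where
      const-sum : ∀ k → ∑[ c < k ] n ≡ k * n
      const-sum zero    = refl
      const-sum (suc k) = cong (n +_) (const-sum k)

    -- Agreement in two columns would make the rows equal, while `r` agrees with itself in all k = 1
    -- + n columns.
    agreements≤ : ∀ r r′ → agreements r r′ ≤ 1 + χ (r ≡ᵇ r′) * n
    agreements≤ r r′ with r Fin.≟ r′
    ... | no r≢r′ = sum-χ≤1 (λ c → b r c ≡ᵇ b r′ c) agree-unique
      where
      agree-unique : ∀ {c d} → (b r c ≡ᵇ b r′ c) ≡ true → (b r d ≡ᵇ b r′ d) ≡ true → c ≡ d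
      agree-unique {c} {d} p q with c Fin.≟ d
      ... | yes c≡d = c≡d
      ... | no c≢d  = contradiction (row-unique c≢d (≡ᵇ-sound p) (≡ᵇ-sound q)) r≢r′
    ... | yes _ rewrite ℕₚ.+-identityʳ n | sym k≡1+n =
      subst (agreements r r′ ≤_) (∑-one k) (sum-mono λ c → χ≤1 (b r c ≡ᵇ b r′ c))
      where
      χ≤1 : ∀ a → χ a ≤ 1
      χ≤1 true  = s≤s z≤n
      χ≤1 false = z≤n

    -- Summed over all rows, both sides of `agreements≤` equal (n + 1) n = n² + n, so equality holds
    -- for each row.
    agreements≡1 : ∀ {r r′} → r ≢ r′ → agreements r r′ ≡ 1
    agreements≡1 {r} {r′} r≢r′ = trans (≤∧sum≡⇒≗ (agreements≤ r) total r′)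
      (cong (λ a → 1 + χ a * n) (dec-false (r Fin.≟ r′) r≢r′))
      where
      open ≡-Reasoning
      total : ∑[ s < N ] agreements r s ≡ ∑[ s < N ] (1 + χ (r ≡ᵇ s) * n)
      total = begin
        ∑[ s < N ] agreements r s                    ≡⟨ ∑-agreements r ⟩
        k * n                                        ≡⟨ cong (_* n) k≡1+n ⟩
        n + n * n                                    ≡⟨ ℕₚ.+-comm n (n * n) ⟩
        n * n + n                                    ≡⟨ cong (_+ n) (sym N≡n*n) ⟩
        N + n                                        ≡⟨ cong₂ _+_ (sym (∑-one N)) (sym (sum-δ r (λ _ → n))) ⟩
        ∑[ s < N ] 1 + ∑[ s < N ] (χ (r ≡ᵇ s) * n)   ≡⟨ sym (∑-distrib-+ {N} (λ _ → 1) _) ⟩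
        ∑[ s < N ] (1 + χ (r ≡ᵇ s) * n)              ∎

  -- Data.Parity gives _+_ and _*_ the same precedence.
  open Data.Parity using (_*_) renaming (_+_ to infixl 6 _+_)
  open ℙΣ
  open ≡-Reasoning

  -- Inversions in columns and parities of the lexicographic orders

  inversions : Fin k → Parity
  inversions c = ∑[ r < N ] ∑[ r′ < N ] (χ (r <ᵇ r′) * χ (b r′ c <ᵇ b r c))

  ties : Fin k → Fin k → Parity
  ties c d = ∑[ r < N ] ∑[ r′ < N ]
    (χ (r <ᵇ r′) * (χ (b r c ≡ᵇ b r′ c) * χ (b r′ d <ᵇ b r d)))

  -- P(c,d) of the header; meaningful only for c ≢ d.
  lexParity : Fin k → Fin k → Parity
  lexParity c d = inversions c + ties c d

  -- The map `ρ` is left open because the squares of the ensemble look up a row by its two columns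
  -- in either order.
  sum-rows : ∀ {c d} → c ≢ d → {ρ : Fin n → Fin n → Fin N} →
    (∀ x y → b (ρ x y) c ≡ x) → (∀ x y → b (ρ x y) d ≡ y) →
    (f : Fin N → Parity) → sum f ≡ ∑[ x < n ] ∑[ y < n ] f (ρ x y)
  sum-rows c≢d {ρ} ρc ρd f = ℙΣ.sum-reindex ρ (λ r → b r _) (λ r → b r _) ρc ρd
    (λ r → row-unique c≢d (ρc _ _) (ρd _ _)) f

  sum-row-pairs : ∀ {c d} → c ≢ d → {ρ : Fin n → Fin n → Fin N} →
    (∀ x y → b (ρ x y) c ≡ x) → (∀ x y → b (ρ x y) d ≡ y) →
    (f : Fin N → Fin N → Parity) → ∑[ r < N ] ∑[ r′ < N ] f r r′ ≡
    ∑[ x < n ] ∑[ y < n ] ∑[ x′ < n ] ∑[ y′ < n ] f (ρ x y) (ρ x′ y′)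
  sum-row-pairs c≢d {ρ} ρc ρd f = trans (sum-rows c≢d ρc ρd (λ r → sum (f r)))
    (sum-cong₂ λ x y → sum-rows c≢d ρc ρd (f (ρ x y)))

  cancel-common : ∀ a p q → (a + p) + (a + q) ≡ p + q
  cancel-common 0ℙ p  q  = refl
  cancel-common 1ℙ 0ℙ 0ℙ = refl
  cancel-common 1ℙ 0ℙ 1ℙ = refl
  cancel-common 1ℙ 1ℙ 0ℙ = refl
  cancel-common 1ℙ 1ℙ 1ℙ = refl

  module _ {c d e : Fin k} (c≢d : c ≢ d) (c≢e : c ≢ e) {ρ : Fin n → Fin n → Fin N}
    (ρc : ∀ x y → b (ρ x y) c ≡ x) (ρd : ∀ x y → b (ρ x y) d ≡ y) where

    private
      disorder : Fin N → Fin N → Parity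
      disorder r r′ = χ (b r c ≡ᵇ b r′ c) * (χ (b r d <ᵇ b r′ d) * χ (b r′ e <ᵇ b r e))

      disorder-refl : ∀ r → disorder r r ≡ 0ℙ
      disorder-refl r rewrite <ᵇ-irrefl (b r d) = ℙ.*-zeroʳ _

      -- Distinct rows tied in c differ in d and in e. These two columns order them oppositely
      -- exactly when one of the two is inverted, which is a sum modulo 2.
      disorder-pair : ∀ r r′ →
        χ (r <ᵇ r′) * (disorder r r′ + disorder r′ r) ≡
        χ (r <ᵇ r′) * (χ (b r c ≡ᵇ b r′ c) * χ (b r′ d <ᵇ b r d)) +
        χ (r <ᵇ r′) * (χ (b r c ≡ᵇ b r′ c) * χ (b r′ e <ᵇ b r e))
      disorder-pair r r′ rewrite ≡ᵇ-sym (b r′ c) (b r c) with compare r r′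
      ... | equal _ p _ _ rewrite p = refl
      ... | greater p _ _ rewrite p = refl
      ... | less p _ _ rewrite p with compare (b r c) (b r′ c)
      ...   | less _ q _ rewrite q = refl
      ...   | greater _ q _ rewrite q = refl
      ...   | equal same _ q _ rewrite q with compare (b r d) (b r′ d) | compare (b r e) (b r′ e)
      ...     | equal same′ _ _ _ | _ = contradiction (row-unique c≢d same same′) (Fin.<⇒≢ (<ᵇ-sound r r′ p))
      ...     | _ | equal same′ _ _ _ = contradiction (row-unique c≢e same same′) (Fin.<⇒≢ (<ᵇ-sound r r′ p))
      ...     | less d₁ _ d₂ | less e₁ _ e₂ rewrite d₁ | d₂ | e₂ = refl
      ...     | less d₁ _ d₂ | greater e₁ _ e₂ rewrite d₁ | d₂ | e₂ = refl
      ...     | greater d₁ _ d₂ | less e₁ _ e₂ rewrite d₁ | d₂ | e₁ | e₂ = refl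
      ...     | greater d₁ _ d₂ | greater e₁ _ e₂ rewrite d₁ | d₂ | e₁ | e₂ = refl

      -- The tie in column c forces x′ = x; what remains are inversions of the map y ↦
      -- `b (ρ x y) e`.
      disorder-ρ : ∀ x y →
        ∑[ x′ < n ] ∑[ y′ < n ] disorder (ρ x y) (ρ x′ y′) ≡
        ∑[ y′ < n ] χ ((y <ᵇ y′) ∧ (b (ρ x y′) e <ᵇ b (ρ x y) e))
      disorder-ρ x y = begin
        ∑[ x′ < n ] ∑[ y′ < n ] disorder (ρ x y) (ρ x′ y′)
          ≡⟨ sum-cong₂ {n} {n} (λ x′ y′ → pointwise x′ y′) ⟩
        ∑[ x′ < n ] ∑[ y′ < n ] (χ (x ≡ᵇ x′) * inverted x′ y′)
          ≡⟨ sum-cong-≗ {n} (λ x′ → sym (*-distribˡ-sum {n} (χ (x ≡ᵇ x′)) (inverted x′))) ⟩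
        ∑[ x′ < n ] (χ (x ≡ᵇ x′) * ∑[ y′ < n ] inverted x′ y′)
          ≡⟨ sum-δ x (λ x′ → ∑[ y′ < n ] inverted x′ y′) ⟩
        ∑[ y′ < n ] inverted x y′ ∎
        where
        inverted : Fin n → Fin n → Parity
        inverted x′ y′ = χ ((y <ᵇ y′) ∧ (b (ρ x′ y′) e <ᵇ b (ρ x y) e))

        pointwise : ∀ x′ y′ → disorder (ρ x y) (ρ x′ y′) ≡ χ (x ≡ᵇ x′) * inverted x′ y′
        pointwise x′ y′ rewrite χ-∧ (y <ᵇ y′) (b (ρ x′ y′) e <ᵇ b (ρ x y) e)
          | ρc x y | ρd x y | ρc x′ y′ | ρd x′ y′ = refl

    -- An inversion in one of these maps is a pair of rows tied in c and ordered oppositely by d and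
    -- e. Suitable choices of c, d, e give the row-, column- and symbol-parity.
    ∑-inversions : ∑[ x < n ] ∑[ y < n ] ∑[ y′ < n ] χ ((y <ᵇ y′) ∧ (b (ρ x y′) e <ᵇ b (ρ x y) e)) ≡
                   lexParity c d + lexParity c e
    ∑-inversions = begin
      ∑[ x < n ] ∑[ y < n ] ∑[ y′ < n ] χ ((y <ᵇ y′) ∧ (b (ρ x y′) e <ᵇ b (ρ x y) e))
        ≡⟨ sum-cong₂ {n} {n} (λ x y → sym (disorder-ρ x y)) ⟩
      ∑[ x < n ] ∑[ y < n ] ∑[ x′ < n ] ∑[ y′ < n ] disorder (ρ x y) (ρ x′ y′)
        ≡⟨ sym (sum-row-pairs c≢d ρc ρd disorder) ⟩
      ∑[ r < N ] ∑[ r′ < N ] disorder r r′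
        ≡⟨ ∑∑-unordered disorder ⟩
      ∑[ r < N ] disorder r r + ∑[ r < N ] ∑[ r′ < N ] (χ (r <ᵇ r′) * (disorder r r′ + disorder r′ r))
        ≡⟨ cong₂ _+_ (sum-zero disorder-refl) (sum-cong₂ disorder-pair) ⟩
      ∑[ r < N ] ∑[ r′ < N ]
        (χ (r <ᵇ r′) * (χ (b r c ≡ᵇ b r′ c) * χ (b r′ d <ᵇ b r d)) +
         χ (r <ᵇ r′) * (χ (b r c ≡ᵇ b r′ c) * χ (b r′ e <ᵇ b r e)))
        ≡⟨ ∑∑-distrib-+ {N} {N} _ _ ⟩
      ties c d + ties c e
        -- Two copies of `inversions c` cancel modulo 2, so they can be inserted to complete the
        -- ties to lexicographic parities.
        ≡⟨ sym (cancel-common (inversions c) (ties c d) (ties c e)) ⟩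
      lexParity c d + lexParity c e ∎

  ascents : Parity
  ascents = ∑[ x < n ] ∑[ x′ < n ] χ (x <ᵇ x′)

  module _ {c d : Fin k} (c≢d : c ≢ d) where

    private
      disagree : Fin N → Fin N → Parity
      disagree r r′ = χ (b r c <ᵇ b r′ c) * χ (b r′ d <ᵇ b r d)

      disagree-refl : ∀ r → disagree r r ≡ 0ℙ
      disagree-refl r rewrite <ᵇ-irrefl (b r c) = refl

      -- Rows tied in one column are compared by the other in both lexicographic orders and cancel;
      -- rows that differ in both columns count when c and d order them oppositely.
      disagree-pair : ∀ r r′ →
        (χ (r <ᵇ r′) * χ (b r′ c <ᵇ b r c) +
         χ (r <ᵇ r′) * (χ (b r c ≡ᵇ b r′ c) * χ (b r′ d <ᵇ b r d))) +
        (χ (r <ᵇ r′) * χ (b r′ d <ᵇ b r d) +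
         χ (r <ᵇ r′) * (χ (b r d ≡ᵇ b r′ d) * χ (b r′ c <ᵇ b r c))) ≡
        χ (r <ᵇ r′) * (disagree r r′ + disagree r′ r)
      disagree-pair r r′ with compare r r′
      ... | equal _ p _ _ rewrite p = refl
      ... | greater p _ _ rewrite p = refl
      ... | less p _ _ rewrite p with compare (b r c) (b r′ c) | compare (b r d) (b r′ d)
      ...   | equal same _ _ _ | equal same′ _ _ _ =
        contradiction (row-unique c≢d same same′) (Fin.<⇒≢ (<ᵇ-sound r r′ p))
      ...   | equal _ c₁ c₂ c₃ | less d₁ d₂ d₃ rewrite c₁ | c₂ | c₃ | d₂ | d₃ = refl
      ...   | equal _ c₁ c₂ c₃ | greater d₁ d₂ d₃ rewrite c₁ | c₂ | c₃ | d₂ | d₃ = refl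
      ...   | less c₁ c₂ c₃ | equal _ d₁ d₂ d₃ rewrite c₁ | c₂ | c₃ | d₂ | d₃ = refl
      ...   | less c₁ c₂ c₃ | less d₁ d₂ d₃ rewrite c₁ | c₂ | c₃ | d₂ | d₃ = refl
      ...   | less c₁ c₂ c₃ | greater d₁ d₂ d₃ rewrite c₁ | c₂ | c₃ | d₂ | d₃ = refl
      ...   | greater c₁ c₂ c₃ | equal _ d₁ d₂ d₃ rewrite c₁ | c₂ | c₃ | d₁ | d₂ | d₃ = refl
      ...   | greater c₁ c₂ c₃ | less d₁ d₂ d₃ rewrite c₁ | c₂ | c₃ | d₁ | d₂ | d₃ = refl
      ...   | greater c₁ c₂ c₃ | greater d₁ d₂ d₃ rewrite c₁ | c₂ | c₃ | d₁ | d₂ | d₃ = refl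

    -- Each pair of symbols occurs in one row, so the pairs of rows that c and d order oppositely
    -- are the free choices of x < x′ in c and y′ < y in d. There are C(n,2)² of them, and `ascents`
    -- is C(n,2) modulo 2.
    lexParity-swap : lexParity c d + lexParity d c ≡ ascents * ascents
    lexParity-swap = begin
      lexParity c d + lexParity d c
        ≡⟨ sym (trans (∑∑-distrib-+ {N} {N} _ _)
             (cong₂ _+_ (∑∑-distrib-+ {N} {N} _ _) (∑∑-distrib-+ {N} {N} _ _))) ⟩
      ∑[ r < N ] ∑[ r′ < N ]
        ((χ (r <ᵇ r′) * χ (b r′ c <ᵇ b r c) +
          χ (r <ᵇ r′) * (χ (b r c ≡ᵇ b r′ c) * χ (b r′ d <ᵇ b r d))) +
         (χ (r <ᵇ r′) * χ (b r′ d <ᵇ b r d) +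
          χ (r <ᵇ r′) * (χ (b r d ≡ᵇ b r′ d) * χ (b r′ c <ᵇ b r c))))
        ≡⟨ sum-cong₂ disagree-pair ⟩
      ∑[ r < N ] ∑[ r′ < N ] (χ (r <ᵇ r′) * (disagree r r′ + disagree r′ r))
        ≡⟨ cong (_+ ∑[ r < N ] ∑[ r′ < N ] (χ (r <ᵇ r′) * (disagree r r′ + disagree r′ r)))
             (sym (sum-zero disagree-refl)) ⟩
      ∑[ r < N ] disagree r r + ∑[ r < N ] ∑[ r′ < N ] (χ (r <ᵇ r′) * (disagree r r′ + disagree r′ r))
        ≡⟨ sym (∑∑-unordered disagree) ⟩
      ∑[ r < N ] ∑[ r′ < N ] disagree r r′
        ≡⟨ sum-row-pairs c≢d (row-fst c≢d) (row-snd c≢d) disagree ⟩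
      ∑[ x < n ] ∑[ y < n ] ∑[ x′ < n ] ∑[ y′ < n ] disagree (row c≢d x y) (row c≢d x′ y′)
        ≡⟨ sum-cong₂ {n} {n} (λ x y → sum-cong₂ {n} {n} (pointwise x y)) ⟩
      ∑[ x < n ] ∑[ y < n ] ∑[ x′ < n ] ∑[ y′ < n ] (χ (x <ᵇ x′) * χ (y′ <ᵇ y))
        ≡⟨ sum-cong₂ {n} {n} (λ x y → sym (sum-*-sum {n} {n} (λ x′ → χ (x <ᵇ x′)) (λ y′ → χ (y′ <ᵇ y)))) ⟩
      ∑[ x < n ] ∑[ y < n ] (∑[ x′ < n ] χ (x <ᵇ x′) * ∑[ y′ < n ] χ (y′ <ᵇ y))
        ≡⟨ sym (sum-*-sum {n} {n} (λ x → ∑[ x′ < n ] χ (x <ᵇ x′)) (λ y → ∑[ y′ < n ] χ (y′ <ᵇ y))) ⟩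
      ascents * ∑[ y < n ] ∑[ y′ < n ] χ (y′ <ᵇ y)
        ≡⟨ cong (ascents *_) (∑-comm {n} {n} (λ y y′ → χ (y′ <ᵇ y))) ⟩
      ascents * ascents ∎
      where
      pointwise : ∀ x y x′ y′ →
        disagree (row c≢d x y) (row c≢d x′ y′) ≡ χ (x <ᵇ x′) * χ (y′ <ᵇ y)
      pointwise x y x′ y′ rewrite row-fst c≢d x y | row-snd c≢d x y
        | row-fst c≢d x′ y′ | row-snd c≢d x′ y′ = refl

  module _ (agree-once : ∀ {r r′} → r ≢ r′ → ∑[ c < k ] χ (b r c ≡ᵇ b r′ c) ≡ 1ℙ) where

    -- After the sums are interchanged, the column in which two rows agree contributes a factor 1,
    -- whatever the two rows are.
    ∑-ties : ∀ d → ∑[ c < k ] ties c d ≡ inversions d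
    ∑-ties d = begin
      ∑[ c < k ] ∑[ r < N ] ∑[ r′ < N ] tie c r r′
        ≡⟨ ∑-comm {k} {N} _ ⟩
      ∑[ r < N ] ∑[ c < k ] ∑[ r′ < N ] tie c r r′
        ≡⟨ sum-cong-≗ {N} (λ r → ∑-comm {k} {N} _) ⟩
      ∑[ r < N ] ∑[ r′ < N ] ∑[ c < k ] tie c r r′
        ≡⟨ sum-cong₂ {N} {N} pointwise ⟩
      inversions d ∎
      where
      tie : Fin k → Fin N → Fin N → Parity
      tie c r r′ = χ (r <ᵇ r′) * (χ (b r c ≡ᵇ b r′ c) * χ (b r′ d <ᵇ b r d))

      pointwise : ∀ r r′ → ∑[ c < k ] tie c r r′ ≡ χ (r <ᵇ r′) * χ (b r′ d <ᵇ b r d)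
      pointwise r r′ with compare r r′
      ... | equal _ p _ _ rewrite p = sum-zero {k} λ _ → refl
      ... | greater p _ _ rewrite p = sum-zero {k} λ _ → refl
      ... | less p _ _ rewrite p = begin
        ∑[ c < k ] (χ (b r c ≡ᵇ b r′ c) * χ (b r′ d <ᵇ b r d))
          ≡⟨ sym (*-distribʳ-sum {k} (χ (b r′ d <ᵇ b r d)) (λ c → χ (b r c ≡ᵇ b r′ c))) ⟩
        ∑[ c < k ] χ (b r c ≡ᵇ b r′ c) * χ (b r′ d <ᵇ b r d)
          ≡⟨ cong (_* χ (b r′ d <ᵇ b r d)) (agree-once (Fin.<⇒≢ (<ᵇ-sound r r′ p))) ⟩
        χ (b r′ d <ᵇ b r d) ∎

    ties-refl : ∀ d → ties d d ≡ 0ℙ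
    ties-refl d = sum-zero {N} λ r → sum-zero {N} (pointwise r)
      where
      pointwise : ∀ r r′ → χ (r <ᵇ r′) * (χ (b r d ≡ᵇ b r′ d) * χ (b r′ d <ᵇ b r d)) ≡ 0ℙ
      pointwise r r′ with compare (b r d) (b r′ d)
      ... | less _ p _ rewrite p = ℙ.*-zeroʳ (χ (r <ᵇ r′))
      ... | equal _ _ p q rewrite p | q = ℙ.*-zeroʳ (χ (r <ᵇ r′))
      ... | greater _ p _ rewrite p = ℙ.*-zeroʳ (χ (r <ᵇ r′))

    -- The `inversions c` with c ≠ d lack only `inversions d`, which the ties supply. The result is
    -- independent of `d`, which makes all scores have the same parity.
    ∑-lexParity : ∀ d → ∑[ c < k ] (χ (not (d ≡ᵇ c)) * lexParity c d) ≡ ∑[ c < k ] inversions c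
    ∑-lexParity d = begin
      ∑[ c < k ] (χ (not (d ≡ᵇ c)) * lexParity c d)
        ≡⟨ sum-cong-≗ {k} split ⟩
      ∑[ c < k ] ((inversions c + χ (d ≡ᵇ c) * inversions c) + ties c d)
        ≡⟨ trans (∑-distrib-+ {k} _ (λ c → ties c d))
             (cong₂ _+_ (∑-distrib-+ {k} inversions _) (∑-ties d)) ⟩
      (∑[ c < k ] inversions c + ∑[ c < k ] (χ (d ≡ᵇ c) * inversions c)) + inversions d
        ≡⟨ cong (λ a → (∑[ c < k ] inversions c + a) + inversions d) (sum-δ d inversions) ⟩
      (∑[ c < k ] inversions c + inversions d) + inversions d
        ≡⟨ trans (ℙ.+-assoc (sum inversions) _ _)
             (cong (sum inversions +_) (ℙ.p+p≡0ℙ (inversions d))) ⟩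
      ∑[ c < k ] inversions c + 0ℙ
        ≡⟨ ℙ.+-identityʳ _ ⟩
      ∑[ c < k ] inversions c ∎
      where
      split : ∀ c → χ (not (d ≡ᵇ c)) * lexParity c d ≡
                    (inversions c + χ (d ≡ᵇ c) * inversions c) + ties c d
      split c with d Fin.≟ c
      ... | no _ rewrite ℙ.+-identityʳ (inversions c) = refl
      ... | yes refl rewrite ties-refl d | ℙ.p+p≡0ℙ (inversions d) = refl

-- The ensemble

open import Data.Nat using (_+_; _*_; _≤_)

-- Four consecutive terms of the sum 0 + 1 + 2 + ... add up to an even number, so the parity of
-- C(n,2) has period 4 in n; C(2,2) = 1 and C(3,2) = 3.
parity-triangular : ∀ n → n % 4 ≡ 2 ⊎ n % 4 ≡ 3 → ℕ.parity (triangular n) ≡ 1ℙ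
parity-triangular n n%4 =
  trans (cong (ℕ.parity ∘ triangular) (trans (m≡m%n+[m/n]*n n 4) (ℕₚ.+-comm (n % 4) _)))
        (trans (periodic (n / 4) (n % 4)) (base n%4))
  where
  four-terms : ∀ j t → 3 + j + (2 + j + (1 + j + (j + t))) ≡ 2 * (2 * j + 3) + t
  four-terms = ℕ-Solver.solve-∀

  parity-double : ∀ a t → ℕ.parity (2 * a + t) ≡ ℕ.parity t
  parity-double a t = trans (ℙ.+-homo-+ (2 * a) t) (cong (ℙ._+ ℕ.parity t) (ℙ.*-homo-* 2 a))

  periodic : ∀ q r → ℕ.parity (triangular (q * 4 + r)) ≡ ℕ.parity (triangular r)
  periodic zero    r = refl
  periodic (suc q) r = trans (cong ℕ.parity (four-terms j (triangular j)))
    (trans (parity-double (2 * j + 3) (triangular j)) (periodic q r))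
    where j = q * 4 + r

  base : ∀ {r} → r ≡ 2 ⊎ r ≡ 3 → ℕ.parity (triangular r) ≡ 1ℙ
  base (inj₁ refl) = refl
  base (inj₂ refl) = refl

-- Counting over the list of column triples

module ListCounting where
  open ℕΣ using (χ; sum-syntax; sum-cong-≗; sum-cong₂)
  open Lists

  length-filter-mapMaybe : {A B C : Set} {P : Pred C 0ℓ} (P? : Decidable P)
    (g : B → C) (h : A → Maybe B) (xs : List A) →
    length (filter P? (map g (mapMaybe h xs))) ≡
    ∑ (λ a → maybe′ (λ b → χ (does (P? (g b)))) 0 (h a)) xs
  length-filter-mapMaybe P? g h [] = refl
  length-filter-mapMaybe P? g h (a ∷ xs) with h a
  ... | nothing = length-filter-mapMaybe P? g h xs
  ... | just b with does (P? (g b))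
  ...   | true  = cong suc (length-filter-mapMaybe P? g h xs)
  ...   | false = length-filter-mapMaybe P? g h xs

  ∑-cartesianProduct : {A B : Set} (f : A × B → ℕ) (xs : List A) (ys : List B) →
    ∑ f (cartesianProduct xs ys) ≡ ∑ (λ a → ∑ (λ b → f (a , b)) ys) xs
  ∑-cartesianProduct f [] ys = refl
  ∑-cartesianProduct f (a ∷ xs) ys = trans
    (cong ListAction.sum (map-++ f (map (a ,_) ys) (cartesianProduct xs ys)))
    (trans (sum-++ (map f (map (a ,_) ys)) (map f (cartesianProduct xs ys)))
           (cong₂ _+_ (cong ListAction.sum (sym (map-∘ ys))) (∑-cartesianProduct f xs ys)))

  ∑-allFin³ : ∀ k (f : Fin k × Fin k × Fin k → ℕ) →
    ∑ f (cartesianProduct (allFin k) (cartesianProduct (allFin k) (allFin k))) ≡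
    ∑[ i < k ] ∑[ j < k ] ∑[ ℓ < k ] f (i , j , ℓ)
  ∑-allFin³ k f = begin
    ∑ f (cartesianProduct (allFin k) (cartesianProduct (allFin k) (allFin k)))
      ≡⟨ ∑-cartesianProduct f (allFin k) _ ⟩
    ∑ (λ i → ∑ (λ (j , ℓ) → f (i , j , ℓ)) (cartesianProduct (allFin k) (allFin k))) (allFin k)
      ≡⟨ ∑-tabulate (λ i → ∑ (λ (j , ℓ) → f (i , j , ℓ)) (cartesianProduct (allFin k) (allFin k))) id ⟩
    ∑[ i < k ] ∑ (λ (j , ℓ) → f (i , j , ℓ)) (cartesianProduct (allFin k) (allFin k))
      ≡⟨ sum-cong-≗ {k} (λ i → ∑-cartesianProduct (λ (j , ℓ) → f (i , j , ℓ)) (allFin k) (allFin k)) ⟩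
    ∑[ i < k ] ∑ (λ j → ∑ (λ ℓ → f (i , j , ℓ)) (allFin k)) (allFin k)
      ≡⟨ sum-cong-≗ {k} (λ i → ∑-tabulate (λ j → ∑ (λ ℓ → f (i , j , ℓ)) (allFin k)) id) ⟩
    ∑[ i < k ] ∑[ j < k ] ∑ (λ ℓ → f (i , j , ℓ)) (allFin k)
      ≡⟨ sum-cong₂ {k} {k} (λ i j → ∑-tabulate (λ ℓ → f (i , j , ℓ)) id) ⟩
    ∑[ i < k ] ∑[ j < k ] ∑[ ℓ < k ] f (i , j , ℓ) ∎
    where open ≡-Reasoning

  -- Stated for arbitrary decisions so that matching on them evaluates `dec⇒maybe`; triples that are
  -- not increasing contribute 0.
  guarded : {A B T : Set} (a? : Dec A) (b? : Dec B) (f : A × B → T) (g : T → ℕ) (c : ℕ) →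
    (∀ p → g (f p) ≡ c) →
    maybe′ g 0 (Maybe.map f (dec⇒maybe (a? ×-dec b?))) ≡ χ (does a?) * χ (does b?) * c
  guarded (yes a) (yes b) f g c h = trans (h (a , b)) (sym (ℕₚ.+-identityʳ c))
  guarded (yes _) (no _)  f g c h = refl
  guarded (no _)  b?      f g c h = refl

-- The tournament on the columns of an orthogonal array

bit : Parity → ℕ
bit 0ℙ = 0
bit 1ℙ = 1

parity-bit : ∀ p → ℕ.parity (bit p) ≡ p
parity-bit 0ℙ = refl
parity-bit 1ℙ = refl

module OrthogonalArray {n : ℕ} {Λ : Set} (2≤n : 2 ≤ n) (n%4 : n % 4 ≡ 2 ⊎ n % 4 ≡ 3)
  (A : OA (n + 1) n Λ) where

  open OA A
  open Inverse enum using (to; from; strictlyInverseˡ; strictlyInverseʳ)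

  k : ℕ
  k = n + 1

  entries : Fin (n ℕ.^ 2) → Fin k → Fin n
  entries r c = to (array r c)

  row : ∀ {c d} → c ≢ d → Fin n → Fin n → Fin (n ℕ.^ 2)
  row c≢d x y = proj₁ (orthogonal c≢d (from x) (from y))

  row-fst : ∀ {c d} (c≢d : c ≢ d) x y → entries (row c≢d x y) c ≡ x
  row-fst c≢d x y =
    trans (cong to (proj₁ (proj₁ (proj₂ (orthogonal c≢d (from x) (from y)))))) (strictlyInverseˡ x)

  row-snd : ∀ {c d} (c≢d : c ≢ d) x y → entries (row c≢d x y) d ≡ y
  row-snd c≢d x y =
    trans (cong to (proj₂ (proj₁ (proj₂ (orthogonal c≢d (from x) (from y)))))) (strictlyInverseˡ y)

  row-unique : ∀ {c d} → c ≢ d → ∀ {r r′} →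
               entries r c ≡ entries r′ c → entries r d ≡ entries r′ d → r ≡ r′
  row-unique {c} {d} c≢d {r} {r′} p q = trans (sym (unique (refl , refl)))
    (unique (injective (sym p) , injective (sym q)))
    where
    injective : ∀ {a b} → to a ≡ to b → a ≡ b
    injective {a} {b} e = trans (sym (strictlyInverseʳ a)) (trans (cong from e) (strictlyInverseʳ b))

    unique = proj₂ (proj₂ (orthogonal c≢d (array r c) (array r d)))

  open Array entries row row-fst row-snd row-unique

  agree-once : ∀ {r r′} → r ≢ r′ → ℙΣ.sum (λ c → ℙΣ.χ (entries r c ≡ᵇ entries r′ c)) ≡ 1ℙ
  agree-once {r} {r′} r≢r′ =
    trans (sym (parity-sum-χ λ c → entries r c ≡ᵇ entries r′ c))
          (cong ℕ.parity (agreements≡1 r≢r′))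
    where
    open Agreement (ℕₚ.+-comm n 1) (cong (n *_) (ℕₚ.*-identityʳ n)) (ℕₚ.≤-trans (s≤s z≤n) 2≤n)

  -- The residue of n modulo 4 enters here: it makes C(n,2), hence its square, odd.
  lexParity-antisym : ∀ {c d} → c ≢ d → lexParity c d ℙ.+ lexParity d c ≡ 1ℙ
  lexParity-antisym c≢d = trans (lexParity-swap c≢d) (cong (λ p → p ℙ.* p) ascents≡1)
    where
    ascents≡1 : ascents ≡ 1ℙ
    ascents≡1 = trans (sym (trans (parity-sum {n} _) (ℙΣ.sum-cong-≗ {n} λ x →
        parity-sum-χ {n} (x <ᵇ_))))
      (trans (cong ℕ.parity (TournamentCounting.∑∑-< n)) (parity-triangular n n%4))

  -- With u beating v when P(v,u) = 1, a score sums P over its first argument, as in `∑-lexParity`.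
  -- The first factor clears the diagonal, where `lexParity` may be odd.
  beats : Fin k → Fin k → ℕ
  beats u v = ℕΣ.χ (not (u ≡ᵇ v)) * bit (lexParity v u)

  beats-≢ : ∀ {u v} → u ≢ v → beats u v ≡ bit (lexParity v u)
  beats-≢ {u} {v} u≢v rewrite dec-false (u Fin.≟ v) u≢v = ℕₚ.+-identityʳ _

  isTournament : IsTournament beats
  isTournament = record { irreflexive = irreflexive ; total = total }
    where
    irreflexive : ∀ u → beats u u ≡ 0
    irreflexive u rewrite dec-true (u Fin.≟ u) refl = refl

    bits : ∀ p q → p ℙ.+ q ≡ 1ℙ → bit p + bit q ≡ 1
    bits 0ℙ .1ℙ refl = refl
    bits 1ℙ 0ℙ refl = refl

    total : ∀ {u v} → u ≢ v → beats u v + beats v u ≡ 1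
    total {u} {v} u≢v = trans (cong₂ _+_ (beats-≢ u≢v) (beats-≢ (u≢v ∘ sym)))
                      (bits (lexParity v u) (lexParity u v) (lexParity-antisym (u≢v ∘ sym)))

  open Tournament isTournament using (score; cyclic; cyclicTriangles)

  parity-score : ∀ u → ℕ.parity (score u) ≡ ℙΣ.sum inversions
  parity-score u = trans (parity-sum (beats u)) (trans (ℙΣ.sum-cong-≗ pointwise) (∑-lexParity agree-once u))
    where
    pointwise : ∀ v → ℕ.parity (beats u v) ≡ ℙΣ.χ (not (u ≡ᵇ v)) ℙ.* lexParity v u
    pointwise v = trans (ℙ.*-homo-* (ℕΣ.χ (not (u ≡ᵇ v))) _)
      (cong₂ ℙ._*_ (parity-χ (not (u ≡ᵇ v))) (parity-bit _))

  n≤4cyclicTriangles : n ≤ 4 * cyclicTriangles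
  n≤4cyclicTriangles = ℕₚ.+-cancelˡ-≤ 1 _ _ (subst (_≤ suc (4 * cyclicTriangles)) (ℕₚ.+-comm n 1)
    (ScoreSequence.SameParity.vertices≤4cyclic isTournament
      λ u v → trans (parity-score u) (sym (parity-score v))))

  module _ (t : ColumnTriple k) where
    open ColumnTriple t

    i≢j : i ≢ j
    i≢j = Fin.<⇒≢ i<j
    j≢ℓ : j ≢ ℓ
    j≢ℓ = Fin.<⇒≢ j<ℓ
    i≢ℓ : i ≢ ℓ
    i≢ℓ = Fin.<⇒≢ (Fin.<-trans i<j j<ℓ)

    -- The definition of `πr` unfolds to the left side of `∑-inversions`, where c, d, e are the
    -- columns of the fixed index, the argument and the value of the permutations.
    πr≡ : πr enum (latinSquare t) ≡ lexParity i j ℙ.+ lexParity i ℓ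
    πr≡ = ∑-inversions i≢j i≢ℓ (row-fst i≢j) (row-snd i≢j)

    πc≡ : πc enum (latinSquare t) ≡ lexParity j i ℙ.+ lexParity j ℓ
    πc≡ = ∑-inversions (i≢j ∘ sym) j≢ℓ {ρ = λ y x → row i≢j x y}
      (λ y x → row-snd i≢j x y) (λ y x → row-fst i≢j x y)

    -- `symbolPerm s` takes x to the witness of `row∃! x s`, which is read off the row found through
    -- columns i and ℓ; this dictates `ρ`.
    πs≡ : πs enum (latinSquare t) ≡ lexParity ℓ i ℙ.+ lexParity ℓ j
    πs≡ = ∑-inversions (i≢ℓ ∘ sym) (j≢ℓ ∘ sym) {ρ = λ s x → row i≢ℓ x s}
      (λ s x → row-snd i≢ℓ x s) (λ s x → row-fst i≢ℓ x s)

    -- The three parities are the out-degrees modulo 2 within the triangle, for arcs c → d with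
    -- P(c,d) = 1: they are 1, 1, 1 in a cycle and 0, 1, 2 in a transitive triangle. Reversing all
    -- arcs, as `beats` does, preserves cycles.
    equiparity≡cyclic : ℕΣ.χ (does (equiparity? enum (latinSquare t))) ≡ cyclic i j ℓ
    equiparity≡cyclic
      rewrite πr≡ | πc≡ | πs≡
            | beats-≢ i≢j | beats-≢ (i≢j ∘ sym) | beats-≢ j≢ℓ | beats-≢ (j≢ℓ ∘ sym)
            | beats-≢ i≢ℓ | beats-≢ (i≢ℓ ∘ sym) =
      cases (lexParity i j) (lexParity j i) (lexParity j ℓ) (lexParity ℓ j) (lexParity ℓ i) (lexParity i ℓ)
        (lexParity-antisym i≢j) (lexParity-antisym j≢ℓ) (lexParity-antisym (i≢ℓ ∘ sym))
      where
      cases : ∀ p p′ q q′ r r′ → p ℙ.+ p′ ≡ 1ℙ → q ℙ.+ q′ ≡ 1ℙ → r ℙ.+ r′ ≡ 1ℙ →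
        ℕΣ.χ (does (((p ℙ.+ r′) ℙ.≟ (p′ ℙ.+ q)) ×-dec ((p′ ℙ.+ q) ℙ.≟ (r ℙ.+ q′)))) ≡
        bit p′ * bit q′ * bit r′ + bit r * bit q * bit p
      cases 0ℙ .1ℙ 0ℙ .1ℙ 0ℙ .1ℙ refl refl refl = refl
      cases 0ℙ .1ℙ 0ℙ .1ℙ 1ℙ 0ℙ refl refl refl = refl
      cases 0ℙ .1ℙ 1ℙ 0ℙ 0ℙ .1ℙ refl refl refl = refl
      cases 0ℙ .1ℙ 1ℙ 0ℙ 1ℙ 0ℙ refl refl refl = refl
      cases 1ℙ 0ℙ 0ℙ .1ℙ 0ℙ .1ℙ refl refl refl = refl
      cases 1ℙ 0ℙ 0ℙ .1ℙ 1ℙ 0ℙ refl refl refl = refl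
      cases 1ℙ 0ℙ 1ℙ 0ℙ 0ℙ .1ℙ refl refl refl = refl
      cases 1ℙ 0ℙ 1ℙ 0ℙ 1ℙ 0ℙ refl refl refl = refl

  equiparityCount≡cyclicTriangles : equiparityCount ≡ cyclicTriangles
  equiparityCount≡cyclicTriangles =
    trans (length-filter-mapMaybe (equiparity? enum) latinSquare _
             (cartesianProduct (allFin k) (cartesianProduct (allFin k) (allFin k))))
    (trans (∑-allFin³ k _)
    (ℕΣ.sum-cong-≗ {k} λ i → ℕΣ.sum-cong₂ {k} {k} λ j ℓ →
      guarded (i Fin.<? j) (j Fin.<? ℓ) (λ (i<j , j<ℓ) → triple i j ℓ i<j j<ℓ)
        (λ t → ℕΣ.χ (does (equiparity? enum (latinSquare t)))) (cyclic i j ℓ)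
        λ (i<j , j<ℓ) → equiparity≡cyclic (triple i j ℓ i<j j<ℓ)))
    where open ListCounting

theorem6p10 : ∀ (n : ℕ) (Λ : Set) → 2 ≤ n → (n % 4 ≡ 2 ⊎ n % 4 ≡ 3) →
    (A : OA (n + 1) n Λ) → ⌈ n / 4 ⌉ ≤ OA.equiparityCount A
theorem6p10 n Λ 2≤n n%4 A = subst (⌈ n / 4 ⌉ ≤_) (sym equiparityCount≡cyclicTriangles)
  -- The ceiling is (n + 3) / 4, so it is at most T once n + 3 < 4 (T + 1).
  (ℕₚ.≤-pred (m<n*o⇒m/o<n (begin-strict
    n + 3                 ≤⟨ ℕₚ.+-monoˡ-≤ 3 n≤4cyclicTriangles ⟩
    4 * T + 3             <⟨ ℕₚ.+-monoʳ-< (4 * T) (ℕₚ.≤-refl {4}) ⟩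
    4 * T + 4             ≡⟨ ℕₚ.+-comm (4 * T) 4 ⟩
    4 + 4 * T             ≡⟨ cong (4 +_) (ℕₚ.*-comm 4 T) ⟩
    suc T * 4             ∎)))
  where
  open ℕₚ.≤-Reasoning
  open OrthogonalArray 2≤n n%4 A
  T = Tournament.cyclicTriangles isTournament
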